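{- For every integer $n\ge 4$, $$\begin{aligned}A_n=\ &2\cdot2^{d_{n,1}}\cdot(d_{n,1})!\cdot(b_{n,1}-d_{n,1})!\cdot\prod_{j=2}^{n-1}2^{d_{n,j}}\cdot(b_{n,j})!\\&+2\cdot2^{d_{n-1,1}}\cdot(d_{n-1,1}+1)!\cdot(b_{n-1,1}-d_{n-1,1})!\cdot\prod_{j=2}^{n-1}2^{d_{n-1,j}}\cdot(b_{n-1,j})!\\&+\sum_{i=3}^{n-2}\Bigl[2^{d_{i,1}+d_{n+1-i,1}}\cdot(d_{i,1}+d_{n+1-i,1})!\cdot(b_{i,1}+b_{n+1-i,1}-d_{i,1}-d_{n+1-i,1})!\\&\qquad\quad\cdot\prod_{j=2}^{n-1}2^{d_{i,j}+d_{n+1-i,j}}\cdot(b_{i,j}+b_{n+1-i,j})!\Bigr].\end{aligned}$$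
   Context: Places $1,\dots,n$ stand in a row; neighbouring places have distance $1$. At any time at which at least one place is occupied, the distance of an empty place $x$ is $\min|x-y|$ over all occupied places $y$. Persons arrive one after another and each occupies one empty place. Basic politeness rule: every person except the first (who chooses freely unless stated otherwise) occupies one of the empty places whose distance is maximal among all empty places at that time. Extended politeness rule: every person except the first (who chooses freely) occupies one of the empty places of maximal distance, and among these one for which the number of occupied places directly neighbouring it is as small as possible. $A_n$ is the number of sequences $(x_1,\dots,x_n)$ (permutations of $\{1,\dots,n\}$, $x_t$ being the place taken by the $t$-th person) in which $n$ persons fill all $n$ places obeying the extended politeness rule. For positive integers $p,k$, consider $p$ places filled by $p$ persons according to the basic politeness rule with the first person taking the leftmost place. $b_{p,k}$ is the number of persons (the first person is not counted) who, at the moment of choosing, occupy a place of distance exactly $k$. $d_{p,k}$ (also for $k=1$) is the number of different sets of two neighbouring places for which, at some time during the filling, both places are empty and both have distance exactly $k$. These numbers do not depend on the choices made during the filling. Empty sums equal $0$. -}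

module Defs where

open import Data.Empty using (⊥-elim)
open import Data.Fin using (Fin; zero; suc; toℕ)
open import Data.Fin.Properties using (injective⇒≤) renaming (_≟_ to _≟ᶠ_; all? to ∀?)
open import Data.List using (List; []; _∷_; length; filter; allFin; applyUpTo;
  cartesianProduct; cartesianProductWith)
open import Data.List.Extrema.Nat using (argmax; argmax-sel; f[xs]≤f[argmax])
open import Data.List.Membership.Propositional using (_∈_; _∉_)
open import Data.List.Membership.Propositional.Properties using (∈-filter⁺; ∈-filter⁻; ∈-allFin)
import Data.List.Membership.Setoid.Properties as Membershipₛ
open import Data.List.NonEmpty as List⁺ using (List⁺; _∷_; _∷⁺_)
open import Data.List.Relation.Unary.All as All using (All; []; _∷_)
open import Data.List.Relation.Unary.Any as Any using (Any)
open import Data.Nat using (ℕ; zero; suc; _+_; _∸_; _≤_; _<_; _⊓_; ∣_-_∣; z<s; _≟_; _≤?_)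
open import Data.Nat.ListAction using (sum; product)
open import Data.Nat.Properties using (<⇒≱; m<m+n; +-suc)
open import Data.Product using (Σ; ∃; _×_; _,_; proj₁; proj₂; uncurry)
open import Data.Sum using (inj₁; inj₂)
open import Data.Unit using (⊤; tt)
open import Data.Vec using (Vec; []; _∷_; toList)
open import Relation.Binary.PropositionalEquality using (_≡_; refl; sym; trans; subst; setoid)
open import Relation.Nullary using (Dec; yes; no)
open import Relation.Nullary.Decidable using (¬?; _×-dec_; _→-dec_)

∑[_⋯_] : ℕ → ℕ → (ℕ → ℕ) → ℕ
∑[ a ⋯ b ] f = sum (applyUpTo (λ i → f (a + i)) (suc b ∸ a))

∏[_⋯_] : ℕ → ℕ → (ℕ → ℕ) → ℕ
∏[ a ⋯ b ] f = product (applyUpTo (λ i → f (a + i)) (suc b ∸ a))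

-- The n places are the elements of Fin n (numbered from 0).  The places
-- occupied at some time are given as a list, most recently taken first; it is
-- nonempty because distances only make sense once somebody is seated.

module _ {n : ℕ} where

  Empty : List⁺ (Fin n) → Fin n → Set
  Empty occ x = x ∉ List⁺.toList occ

  empty? : ∀ occ x → Dec (Empty occ x)
  empty? occ x = ¬? (Any.any? (x ≟ᶠ_) (List⁺.toList occ))

  distance : List⁺ (Fin n) → Fin n → ℕ
  distance occ x = List⁺.foldr₁ _⊓_ (List⁺.map (λ y → ∣ toℕ x - toℕ y ∣) occ)

  occupiedNeighbours : List⁺ (Fin n) → Fin n → ℕ
  occupiedNeighbours occ x =
    length (filter (λ y → (∣ toℕ x - toℕ y ∣ ≟ 1) ×-dec Any.any? (y ≟ᶠ_) (List⁺.toList occ))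
                   (allFin n))

  BasicRule : List⁺ (Fin n) → Fin n → Set
  BasicRule occ x = Empty occ x × (∀ y → Empty occ y → distance occ y ≤ distance occ x)

  ExtendedRule : List⁺ (Fin n) → Fin n → Set
  ExtendedRule occ x =
    BasicRule occ x ×
    (∀ y → BasicRule occ y → occupiedNeighbours occ x ≤ occupiedNeighbours occ y)

  basicRule? : ∀ occ x → Dec (BasicRule occ x)
  basicRule? occ x =
    empty? occ x ×-dec ∀? (λ y → empty? occ y →-dec (distance occ y ≤? distance occ x))

  extendedRule? : ∀ occ x → Dec (ExtendedRule occ x)
  extendedRule? occ x =
    basicRule? occ x ×-dec
    ∀? (λ y → basicRule? occ y →-dec (occupiedNeighbours occ x ≤? occupiedNeighbours occ y))

  -- The arrivals of all persons but the first: each is paired with the places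
  -- occupied just before that person chooses.
  arrivalsAfter : List⁺ (Fin n) → List (Fin n) → List (List⁺ (Fin n) × Fin n)
  arrivalsAfter occ []       = []
  arrivalsAfter occ (x ∷ xs) = (occ , x) ∷ arrivalsAfter (x ∷⁺ occ) xs

  arrivals : List (Fin n) → List (List⁺ (Fin n) × Fin n)
  arrivals []       = []
  arrivals (x ∷ xs) = arrivalsAfter (x ∷ []) xs

  Obeys : (List⁺ (Fin n) → Fin n → Set) → List (Fin n) → Set
  Obeys Rule xs = All (uncurry Rule) (arrivals xs)

  obeysExtended? : ∀ xs → Dec (Obeys ExtendedRule xs)
  obeysExtended? xs = All.all? (uncurry extendedRule?) (arrivals xs)

words : ∀ n m → List (Vec (Fin n) m)
words n zero    = [] ∷ []
words n (suc m) = cartesianProductWith _∷_ (allFin n) (words n m)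

-- Both rules let a person take only an empty place, so every word of length n
-- over Fin n which obeys one of them is automatically a permutation.
A : ℕ → ℕ
A n = length (filter (λ xs → obeysExtended? (toList xs)) (words n n))

LeftmostFirst : ∀ {p} → List (Fin p) → Set
LeftmostFirst []      = ⊤
LeftmostFirst (x ∷ _) = toℕ x ≡ 0

record LeftFilling (p : ℕ) : Set where
  field
    places        : Vec (Fin p) p
    leftmostFirst : LeftmostFirst (toList places)
    basic         : Obeys BasicRule (toList places)

-- The numbers b_{p,k} and d_{p,k}, read off from a given filling of p places.

module _ {p : ℕ} (F : LeftFilling p) where

  open LeftFilling F

  private
    steps : List (List⁺ (Fin p) × Fin p)
    steps = arrivals (toList places)

  personsAtDistance : ℕ → ℕ
  personsAtDistance k = length (filter (λ (occ , x) → distance occ x ≟ k) steps)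

  -- A set of two neighbouring places is represented by (x , y) with y the right
  -- neighbour of x.  It is enough to look at the times just before an arrival,
  -- as no place is empty after the last one.
  IsPairAtDistance : ℕ → Fin p × Fin p → Set
  IsPairAtDistance k (x , y) =
    toℕ y ≡ suc (toℕ x) ×
    Any (λ (occ , _) → (Empty occ x × distance occ x ≡ k) × (Empty occ y × distance occ y ≡ k))
        steps

  isPairAtDistance? : ∀ k xy → Dec (IsPairAtDistance k xy)
  isPairAtDistance? k (x , y) =
    (toℕ y ≟ suc (toℕ x)) ×-dec
    Any.any? (λ (occ , _) → (empty? occ x ×-dec (distance occ x ≟ k)) ×-dec
                            (empty? occ y ×-dec (distance occ y ≟ k)))
             steps

  pairsAtDistance : ℕ → ℕ
  pairsAtDistance k =
    length (filter (isPairAtDistance? k) (cartesianProduct (allFin p) (allFin p)))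

-- Fillings of the kind used to define b_{p,k} and d_{p,k} exist for every p.

private
  module _ {p : ℕ} (occ : List⁺ (Fin p)) (small : List⁺.length occ < p) where

    empties : List (Fin p)
    empties = filter (empty? occ) (allFin p)

    someEmpty : ∃ λ x → x ∈ empties
    someEmpty with empties in eq
    ... | x ∷ _ = x , Any.here refl
    ... | []    = ⊥-elim (<⇒≱ small (injective⇒≤ {f = λ x → Any.index (seated x)} λ {x} {y} →
                    Membershipₛ.index-injective (setoid (Fin p)) (seated x) (seated y)))
      where
      seated : ∀ x → x ∈ List⁺.toList occ
      seated x with Any.any? (x ≟ᶠ_) (List⁺.toList occ)
      ... | yes x∈occ = x∈occ
      ... | no  x∉occ with subst (x ∈_) eq (∈-filter⁺ (empty? occ) (∈-allFin x) x∉occ)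
      ...   | ()

    choose : ∃ (BasicRule occ)
    choose = best , proj₂ (∈-filter⁻ (empty? occ) {xs = allFin p} best∈) , λ y y∉ →
      All.lookup (f[xs]≤f[argmax] {f = distance occ} x₀ empties)
                 (∈-filter⁺ (empty? occ) (∈-allFin y) y∉)
      where
      x₀ best : Fin p
      x₀   = proj₁ someEmpty
      best = argmax (distance occ) x₀ empties
      best∈ : best ∈ empties
      best∈ with argmax-sel (distance occ) x₀ empties
      ... | inj₁ best≡x₀ = subst (_∈ empties) (sym best≡x₀) (proj₂ someEmpty)
      ... | inj₂ b∈      = b∈

  continue : ∀ {p} r (occ : List⁺ (Fin p)) → List⁺.length occ + r ≡ p →
             Σ (Vec (Fin p) r) λ xs → All (uncurry BasicRule) (arrivalsAfter occ (toList xs))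
  continue zero    occ eq = [] , []
  continue (suc r) occ eq =
    let x , ok   = choose occ (subst (List⁺.length occ <_) eq (m<m+n (List⁺.length occ) z<s))
        xs , oks = continue r (x ∷⁺ occ) (trans (sym (+-suc (List⁺.length occ) r)) eq)
    in x ∷ xs , ok ∷ oks

leftFilling : ∀ p → LeftFilling p
leftFilling zero    = record { places = [] ; leftmostFirst = tt ; basic = [] }
leftFilling (suc q) =
  let xs , ok = continue q (zero ∷ []) refl
  in record { places = zero ∷ xs ; leftmostFirst = refl ; basic = ok }

{-# OPTIONS --safe #-}
-- The empty places form gaps: inner gaps between two taken places, and end
-- gaps at either side of the row.  Under the basic rule a gap is always split at
-- its middle (an end gap at its far end), so the multiset of all gaps that ever
-- arise, and with it b and d, does not depend on the choices.
--
-- Under the extended rule, score a place by its distance, but by 0 if both its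
-- neighbours are taken: the rule then says precisely that the score is maximal.
-- A gap of maximal score S splits into gaps of smaller score, so if L gaps of
-- score S ever arise, D of them with two middle places, these are filled in any
-- order and with either choice: 2 ^ D * L ! ways.  Multiplying over all scores
-- and summing over the place of the first person, who leaves two end gaps,
-- gives the formula.
module Submission where

open import Defs
open import Data.Bool using (true; false; if_then_else_)
open import Data.Empty using (⊥; ⊥-elim)
open import Data.Fin using (Fin; zero; suc; toℕ; fromℕ<)
open import Data.Fin.Properties using (toℕ<n; toℕ-injective; toℕ-fromℕ<) renaming (_≟_ to _≟ᶠ_)
open import Data.List using (List; []; _∷_; _++_; map; length; filter; allFin; applyUpTo;
  cartesianProduct; cartesianProductWith)
open import Data.List.Extrema.Nat using (argmax; argmax-sel; f[xs]≤f[argmax]; f[⊥]≤f[argmax])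
open import Data.List.Membership.Propositional using (_∈_; _∉_)
open import Data.List.Membership.Propositional.Properties using (∈-map⁺; ∈-map⁻)
open import Data.List.NonEmpty as List⁺ using (List⁺; _∷_; _∷⁺_)
open import Data.List.Properties using (map-tabulate; map-∘; map-cong; map-++; applyUpTo-∷ʳ)
open import Data.List.Relation.Unary.All as All using (All; []; _∷_)
open import Data.List.Relation.Unary.Any as Any using (Any; here; there; _─_)
open import Data.Nat
open import Data.Nat.ListAction using (sum; product)
open import Data.Nat.ListAction.Properties using (sum-++)
open import Data.Nat.Properties
open import Data.Nat.Tactic.RingSolver using (solve-∀)
open import Data.Product using (∃; ∃₂; _×_; _,_; proj₁; proj₂; uncurry)
open import Data.Sum using (_⊎_; inj₁; inj₂)
open import Data.Vec as Vec using (Vec; toList)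
open import Data.Vec.Properties using (length-toList)
open import Function using (_∘_; id)
open import Relation.Binary.PropositionalEquality
open import Relation.Nullary using (Dec; yes; no; ¬_; does; contradiction)
open import Relation.Nullary.Decidable using (dec-true; dec-false; _×-dec_; _⊎-dec_)

-- The obstacle is that the middle of a gap may be one place or two, and only in the second case is
-- there a choice. Every gap is therefore given two centres, which may coincide, and places are
-- counted with this multiplicity. If L gaps of the top score S are present, the permitted places
-- have total multiplicity 2 * L whatever the parities, and taking a permitted place of multiplicity
-- ω leaves exactly the fraction ω / (2 * L) of the weight. These fractions add up to 1, and that is
-- the whole induction step. The special shape of the formula at distance 1 comes from the scores 0
-- and 1 sharing that distance. Inner gaps of score 1 are those of two places, counted by d, so b -
-- d counts the inner gaps of one place. The one exception is an end gap of one place, which has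
-- score 1 but no pair; it arises only if the first person sits next to an end place, and it is the
-- + 1 in the second line.

private variable
  X Y P Q : Set

-- Sums and indicators

ind : Dec P → ℕ
ind d = if does d then 1 else 0

ind-yes : (d : Dec P) → P → ind d ≡ 1
ind-yes d p rewrite dec-true d p = refl

ind-no : (d : Dec P) → ¬ P → ind d ≡ 0
ind-no d ¬p rewrite dec-false d ¬p = refl

ind-⇔ : (d : Dec P) (e : Dec Q) → (P → Q) → (Q → P) → ind d ≡ ind e
ind-⇔ (yes p) e f g = sym (ind-yes e (f p))
ind-⇔ (no ¬p) e f g = sym (ind-no e (¬p ∘ g))

ind-× : (d : Dec P) (e : Dec Q) → ind (d ×-dec e) ≡ ind d * ind e
ind-× (yes p) e = sym (+-identityʳ _)
ind-× (no ¬p) e = refl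

δ : ℕ → ℕ → ℕ
δ m n = ind (m ≟ n)

δ-≡ : ∀ {m n} → m ≡ n → δ m n ≡ 1
δ-≡ {m} {n} = ind-yes (m ≟ n)

δ-≢ : ∀ {m n} → m ≢ n → δ m n ≡ 0
δ-≢ {m} {n} = ind-no (m ≟ n)

total : (X → ℕ) → List X → ℕ
total f xs = sum (map f xs)

total-cong : {f g : X → ℕ} → (∀ x → f x ≡ g x) → ∀ xs → total f xs ≡ total g xs
total-cong f≗g xs = cong sum (map-cong f≗g xs)

total-cong-∈ : {f g : X → ℕ} → ∀ xs → (∀ {x} → x ∈ xs → f x ≡ g x) → total f xs ≡ total g xs
total-cong-∈ []       eq = refl
total-cong-∈ (x ∷ xs) eq = cong₂ _+_ (eq (here refl)) (total-cong-∈ xs (eq ∘ there))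

total-zero : {f : X → ℕ} → ∀ xs → (∀ {x} → x ∈ xs → f x ≡ 0) → total f xs ≡ 0
total-zero []       eq = refl
total-zero (x ∷ xs) eq = cong₂ _+_ (eq (here refl)) (total-zero xs (eq ∘ there))

total-+ : (f g : X → ℕ) → ∀ xs → total (λ x → f x + g x) xs ≡ total f xs + total g xs
total-+ f g []       = refl
total-+ f g (x ∷ xs) rewrite total-+ f g xs =
  rearrange (f x) (g x) (total f xs) (total g xs)
  where
  rearrange : ∀ a b c d → a + b + (c + d) ≡ a + c + (b + d)
  rearrange = solve-∀

total-* : ∀ c (f : X → ℕ) xs → total (λ x → c * f x) xs ≡ c * total f xs
total-* c f []       = sym (*-zeroʳ c)
total-* c f (x ∷ xs) rewrite total-* c f xs = sym (*-distribˡ-+ c (f x) (total f xs))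

total-swap : (f : X → Y → ℕ) → ∀ xs ys →
             total (λ x → total (f x) ys) xs ≡ total (λ y → total (λ x → f x y) xs) ys
total-swap f []       ys = sym (total-zero ys (λ _ → refl))
total-swap f (x ∷ xs) ys rewrite total-swap f xs ys = sym (total-+ (f x) _ ys)

total-map : (f : Y → ℕ) (g : X → Y) → ∀ xs → total f (map g xs) ≡ total (f ∘ g) xs
total-map f g xs = cong sum (sym (map-∘ xs))

total-++ : (f : X → ℕ) → ∀ xs ys → total f (xs ++ ys) ≡ total f xs + total f ys
total-++ f xs ys = trans (cong sum (map-++ f xs ys)) (sum-++ (map f xs) (map f ys))

total-product : ∀ {Z : Set} (f : Z → ℕ) (h : X → Y → Z) → ∀ xs ys →
                total f (cartesianProductWith h xs ys) ≡ total (λ x → total (λ y → f (h x y)) ys) xs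
total-product f h []       ys = refl
total-product f h (x ∷ xs) ys =
  trans (total-++ f (map (h x) ys) _)
        (cong₂ _+_ (total-map f (h x) ys) (total-product f h xs ys))

length-filter-total : {P : X → Set} (P? : ∀ x → Dec (P x)) → ∀ xs →
                      length (filter P? xs) ≡ total (λ x → ind (P? x)) xs
length-filter-total P? []       = refl
length-filter-total P? (x ∷ xs) with does (P? x)
... | true  = cong suc (length-filter-total P? xs)
... | false = length-filter-total P? xs

∈⇒≤total : (f : X → ℕ) → ∀ {x xs} → x ∈ xs → f x ≤ total f xs
∈⇒≤total f (here refl) = m≤m+n _ _
∈⇒≤total f (there x∈)  = ≤-trans (∈⇒≤total f x∈) (m≤n+m _ _)

total-positive : (f : X → ℕ) → ∀ xs → 1 ≤ total f xs → ∃ λ x → x ∈ xs × 1 ≤ f x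
total-positive f (x ∷ xs) pos with f x in eq
... | suc _ = x , here refl , subst (1 ≤_) (sym eq) z<s
... | zero  = let y , y∈ , q = total-positive f xs pos in y , there y∈ , q

total-─ : (f : X → ℕ) → ∀ {x xs} (p : x ∈ xs) → total f xs ≡ f x + total f (xs ─ p)
total-─ f (here refl) = refl
total-─ f {x} {y ∷ xs} (there p) rewrite total-─ f p =
  rearrange (f y) (f x) (total f (xs ─ p))
  where
  rearrange : ∀ a b c → a + (b + c) ≡ b + (a + c)
  rearrange = solve-∀

All-─ : {P : X → Set} → ∀ {x xs} (p : x ∈ xs) → All P xs → All P (xs ─ p)
All-─ (here refl) (_ ∷ qs) = qs
All-─ (there p)   (q ∷ qs) = q ∷ All-─ p qs

total-allFin-suc : ∀ {n} (f : Fin (suc n) → ℕ) →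
                   total f (allFin (suc n)) ≡ f zero + total (f ∘ suc) (allFin n)
total-allFin-suc f = cong (λ l → f zero + sum l)
  (trans (map-tabulate suc f) (sym (map-tabulate id (f ∘ suc))))

total-δ : ∀ {n a} → a < n → total (λ x → δ a (toℕ x)) (allFin n) ≡ 1
total-δ {suc n} {zero}  _ =
  trans (total-allFin-suc {n} (λ x → δ 0 (toℕ x))) (cong suc (total-zero (allFin n) λ _ → refl))
total-δ {suc n} {suc a} (s≤s a<n) =
  trans (total-allFin-suc {n} (λ x → δ (suc a) (toℕ x))) (total-δ a<n)

total-allFin : ∀ n (f : ℕ → ℕ) → total (f ∘ toℕ) (allFin n) ≡ sum (applyUpTo f n)
total-allFin zero    f = refl
total-allFin (suc n) f =
  trans (total-allFin-suc {n} (f ∘ toℕ)) (cong (f 0 +_) (total-allFin n (f ∘ suc)))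

-- Indicator of the places from `lo` up to but excluding `lo + l`. Being a number and not a
-- predicate, it can be summed over a list of gaps, so that covering and disjointness become one
-- equation.
χ : ℕ → ℕ → ℕ → ℕ
χ lo zero    x = 0
χ lo (suc l) x = δ lo x + χ (suc lo) l x

χ-split : ∀ lo i j x → χ lo (i + suc j) x ≡ χ lo i x + (δ (lo + i) x + χ (suc (lo + i)) j x)
χ-split lo zero    j x rewrite +-identityʳ lo = refl
χ-split lo (suc i) j x rewrite χ-split (suc lo) i j x | +-suc lo i =
  sym (+-assoc (δ lo x) _ _)

χ-hit : ∀ lo i j → 1 ≤ χ lo (suc (i + j)) (lo + i)
χ-hit lo i j = subst (λ l → 1 ≤ χ lo l (lo + i)) (+-suc i j)
  (subst (1 ≤_) (sym (χ-split lo i j (lo + i)))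
    (≤-trans (≤-reflexive (sym (δ-≡ {lo + i} refl))) (≤-trans (m≤m+n (δ (lo + i) (lo + i)) _) (m≤n+m _ (χ lo i (lo + i))))))

χ-∈ : ∀ lo l x → 1 ≤ χ lo l x → ∃₂ λ i j → x ≡ lo + i × l ≡ suc (i + j)
χ-∈ lo (suc l) x pos with lo ≟ x
... | yes refl = 0 , l , sym (+-identityʳ lo) , refl
... | no lo≢x  = let i , j , p , q = χ-∈ (suc lo) l x (subst (λ d → 1 ≤ d + χ (suc lo) l x) (δ-≢ lo≢x) pos) in
                 suc i , j , trans p (sym (+-suc lo i)) , cong suc q

χ-below : ∀ lo l x → x < lo → χ lo l x ≡ 0
χ-below lo zero    x x<lo = refl
χ-below lo (suc l) x x<lo = cong₂ _+_ (δ-≢ (>⇒≢ x<lo)) (χ-below (suc lo) l x (m≤n⇒m≤1+n x<lo))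

χ≤1 : ∀ lo l x → χ lo l x ≤ 1
χ≤1 lo zero    x = z≤n
χ≤1 lo (suc l) x with lo ≟ x
... | yes refl = subst₂ (λ c d → c + d ≤ 1) (sym (δ-≡ {lo} refl)) (sym (χ-below (suc lo) l lo ≤-refl)) ≤-refl
... | no lo≢x  = subst (λ d → d + χ (suc lo) l x ≤ 1) (sym (δ-≢ lo≢x)) (χ≤1 (suc lo) l x)

χ-inside : ∀ {n x} → x < n → χ 0 n x ≡ 1
χ-inside {n} {x} x<n = ≤-antisym (χ≤1 0 n x)
  (subst (λ m → 1 ≤ χ 0 m x) (m+[n∸m]≡n x<n) (χ-hit 0 x (n ∸ suc x)))

χ-inside⁻ : ∀ {n x} → 1 ≤ χ 0 n x → x < n
χ-inside⁻ {n} {x} pos with χ-∈ 0 n x pos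
... | i , j , refl , refl = s≤s (m≤m+n i j)

multiplicity : List ℕ → ℕ → ℕ
multiplicity os x = total (λ y → δ y x) os

∈⇒multiplicity : ∀ {os x} → x ∈ os → 1 ≤ multiplicity os x
∈⇒multiplicity {os} {x} x∈ = ≤-trans (≤-reflexive (sym (δ-≡ {x} refl))) (∈⇒≤total (λ y → δ y x) x∈)

∉⇒multiplicity : ∀ {os x} → x ∉ os → multiplicity os x ≡ 0
∉⇒multiplicity {os} x∉ = total-zero os (λ {y} y∈ → δ-≢ {y} (λ { refl → x∉ y∈ }))

-- Gaps

-- A gap without any wall does not occur, because gaps are considered only once the first person is
-- seated.
data Kind : Set where
  mid endL endR : Kind

-- Length 0 is allowed, so that taking a place always replaces one gap by exactly two.
record Gap : Set where
  constructor gap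
  field
    kind  : Kind
    lo len : ℕ
open Gap

leftPart rightPart : Kind → Kind
leftPart mid  = mid
leftPart endL = endL
leftPart endR = mid
rightPart mid  = mid
rightPart endL = mid
rightPart endR = endR

-- `i` and `j` are the numbers of places of the gap before and after the place considered, so the
-- gap has `suc (i + j)` places.
dist nbrs : Kind → ℕ → ℕ → ℕ
dist mid  i j = suc (i ⊓ j)
dist endL i j = suc j
dist endR i j = suc i
nbrs mid  i j = δ i 0 + δ j 0
nbrs endL i j = δ j 0
nbrs endR i j = δ i 0

-- Here `m` is the length of the gap minus one. `radius` is the largest distance in the gap, and the
-- centres are the offsets attaining it; they coincide in end gaps and in inner gaps of odd length.
radius centre₁ centre₂ : Kind → ℕ → ℕ
radius mid  m = suc ⌊ m /2⌋
radius endL m = suc m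
radius endR m = suc m
centre₁ mid  m = ⌊ m /2⌋
centre₁ endL m = 0
centre₁ endR m = m
centre₂ mid  m = ⌈ m /2⌉
centre₂ endL m = 0
centre₂ endR m = m

centre₁≤ : ∀ κ m → centre₁ κ m ≤ m
centre₁≤ mid  m = ⌊n/2⌋≤n m
centre₁≤ endL m = z≤n
centre₁≤ endR m = ≤-refl

centre₂≤ : ∀ κ m → centre₂ κ m ≤ m
centre₂≤ mid  m = ⌈n/2⌉≤n m
centre₂≤ endL m = z≤n
centre₂≤ endR m = ≤-refl

Central : Kind → ℕ → ℕ → Set
Central κ i j = i ≡ centre₁ κ (i + j) ⊎ i ≡ centre₂ κ (i + j)

other-half : ∀ i j {a b} → a + b ≡ i + j → i ≡ a → j ≡ b
other-half i j {b = b} eq refl = +-cancelˡ-≡ i j b (sym eq)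

other-half′ : ∀ i j {a b} → a + b ≡ i + j → i ≡ b → j ≡ a
other-half′ i j {a} {b} eq = other-half i j (trans (+-comm b a) eq)

central-mid : ∀ i j → Central mid i j →
              (i ≡ ⌊ i + j /2⌋ × j ≡ ⌈ i + j /2⌉) ⊎ (i ≡ ⌈ i + j /2⌉ × j ≡ ⌊ i + j /2⌋)
central-mid i j (inj₁ p) = inj₁ (p , other-half i j (⌊n/2⌋+⌈n/2⌉≡n (i + j)) p)
central-mid i j (inj₂ p) = inj₂ (p , other-half′ i j (⌊n/2⌋+⌈n/2⌉≡n (i + j)) p)

central-endR : ∀ i j → Central endR i j → j ≡ 0
central-endR i j (inj₁ p) = other-half i j (+-identityʳ (i + j)) p
central-endR i j (inj₂ p) = other-half i j (+-identityʳ (i + j)) p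

dist≤radius : ∀ κ i j → dist κ i j ≤ radius κ (i + j)
dist≤radius mid  i j = s≤s (subst (_≤ ⌊ i + j /2⌋) (sym (n≡⌊n+n/2⌋ (i ⊓ j)))
                             (⌊n/2⌋-mono (+-mono-≤ (m⊓n≤m i j) (m⊓n≤n i j))))
dist≤radius endL i j = s≤s (m≤n+m j i)
dist≤radius endR i j = s≤s (m≤m+n i j)

dist-maximal⇒central : ∀ κ i j → radius κ (i + j) ≤ dist κ i j → Central κ i j
-- The smaller of `i` and `j` must be the lower half of their sum; if it is `j`, then `i` is the
-- upper half.
dist-maximal⇒central mid i j r≤d with ⊓-sel i j | ≤-antisym (≤-pred r≤d) (≤-pred (dist≤radius mid i j))
... | inj₁ p | q = inj₁ (trans (sym p) (sym q))
... | inj₂ p | q = inj₂ (other-half j i (trans (⌊n/2⌋+⌈n/2⌉≡n (i + j)) (+-comm i j)) (trans (sym p) (sym q)))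
dist-maximal⇒central endL i j r≤d = inj₁ (n≤0⇒n≡0 (+-cancelʳ-≤ j i 0 (≤-pred r≤d)))
dist-maximal⇒central endR i j r≤d = inj₁ (≤-antisym (m≤m+n i j) (≤-pred r≤d))

central⇒dist-maximal : ∀ κ i j → Central κ i j → dist κ i j ≡ radius κ (i + j)
central⇒dist-maximal mid i j c with central-mid i j c
... | inj₁ (p , q) = cong suc (trans (m≤n⇒m⊓n≡m (subst₂ _≤_ (sym p) (sym q) (⌊n/2⌋≤⌈n/2⌉ (i + j)))) p)
... | inj₂ (p , q) = cong suc (trans (m≥n⇒m⊓n≡n (subst₂ _≤_ (sym q) (sym p) (⌊n/2⌋≤⌈n/2⌉ (i + j)))) q)
central⇒dist-maximal endL i j (inj₁ refl) = refl
central⇒dist-maximal endL i j (inj₂ refl) = refl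
central⇒dist-maximal endR i j (inj₁ p) = cong suc p
central⇒dist-maximal endR i j (inj₂ p) = cong suc p

-- midValue v l adds up v over all gaps that ever arise from an inner gap of
-- length l; here and below, v and w take the length of a gap minus one.
-- The second argument of halve is fuel.
halve : (ℕ → ℕ) → ℕ → ℕ → ℕ
halve v fuel       zero    = 0
halve v zero       (suc m) = 0
halve v (suc fuel) (suc m) = v m + (halve v fuel ⌊ m /2⌋ + halve v fuel ⌈ m /2⌉)

halve-fuel : ∀ v {f g} m → m ≤ f → m ≤ g → halve v f m ≡ halve v g m
halve-fuel v zero    _ _ = refl
halve-fuel v (suc m) (s≤s p) (s≤s q) = cong (v m +_) (cong₂ _+_
  (halve-fuel v ⌊ m /2⌋ (≤-trans (⌊n/2⌋≤n m) p) (≤-trans (⌊n/2⌋≤n m) q))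
  (halve-fuel v ⌈ m /2⌉ (≤-trans (⌈n/2⌉≤n m) p) (≤-trans (⌈n/2⌉≤n m) q)))

midValue : (ℕ → ℕ) → ℕ → ℕ
midValue v l = halve v l l

midValue-suc : ∀ v m → midValue v (suc m) ≡ v m + (midValue v ⌊ m /2⌋ + midValue v ⌈ m /2⌉)
midValue-suc v m = cong (v m +_) (cong₂ _+_
  (halve-fuel v ⌊ m /2⌋ (⌊n/2⌋≤n m) ≤-refl)
  (halve-fuel v ⌈ m /2⌉ (⌈n/2⌉≤n m) ≤-refl))

endValue : (v w : ℕ → ℕ) → ℕ → ℕ
endValue v w zero    = 0
endValue v w (suc m) = w m + midValue v m

value gain : (v w : ℕ → ℕ) → Kind → ℕ → ℕ
value v w mid  = midValue v
value v w endL = endValue v w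
value v w endR = endValue v w
gain v w mid  = v
gain v w endL = w
gain v w endR = w

value-zero : ∀ v w κ → value v w κ 0 ≡ 0
value-zero v w mid  = refl
value-zero v w endL = refl
value-zero v w endR = refl

-- Both centres of an inner gap leave the same two lengths, only in opposite order, and the sum over
-- the two pieces does not see the order. This is where the independence of b and d of all choices
-- comes from.
value-split : ∀ v w κ i j → Central κ i j →
  value v w κ (suc (i + j)) ≡ gain v w κ (i + j) + (value v w (leftPart κ) i + value v w (rightPart κ) j)
value-split v w mid i j c = trans (midValue-suc v (i + j)) (cong (v (i + j) +_) (pieces (central-mid i j c)))
  where
  pieces : _ → midValue v ⌊ i + j /2⌋ + midValue v ⌈ i + j /2⌉ ≡ midValue v i + midValue v j
  pieces (inj₁ (p , q)) = cong₂ (λ a b → midValue v a + midValue v b) (sym p) (sym q)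
  pieces (inj₂ (p , q)) = trans (+-comm (midValue v ⌊ i + j /2⌋) _)
    (cong₂ (λ a b → midValue v a + midValue v b) (sym p) (sym q))
value-split v w endL i j (inj₁ refl) = refl
value-split v w endL i j (inj₂ refl) = refl
value-split v w endR i j c with central-endR i j c
... | refl rewrite +-identityʳ i | +-identityʳ (midValue v i) = refl

-- Different `v` and `w` make this count the future persons at a distance, the pairs, or the gaps of
-- a level, so one splitting lemma serves all of these.
Φ : (v w : ℕ → ℕ) → List Gap → ℕ
Φ v w = total (λ G → value v w (kind G) (len G))

LeftBound : List ℕ → Kind → ℕ → Set
LeftBound os endL lo      = lo ≡ 0
LeftBound os _    zero    = ⊥
LeftBound os _    (suc u) = u ∈ os

RightBound : ℕ → List ℕ → Kind → ℕ → Set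
RightBound n os endR hi = hi ≡ n
RightBound n os _    hi = hi ∈ os

Bounded : ℕ → List ℕ → Gap → Set
Bounded n os G = LeftBound os (kind G) (lo G) × RightBound n os (kind G) (lo G + len G)

-- As `χ` never exceeds 1, the single equation `tiling` says at once that the gaps are disjoint,
-- that no seat lies in a gap or is listed twice, and that gaps and seats make up exactly the row.
record Gaps (n : ℕ) (os : List ℕ) (gs : List Gap) : Set where
  field
    bounded : All (Bounded n os) gs
    tiling  : ∀ x → total (λ G → χ (lo G) (len G) x) gs + multiplicity os x ≡ χ 0 n x

split : ∀ gs {G : Gap} (p : G ∈ gs) (i j : ℕ) → List Gap
split gs {G} p i j = gap (leftPart (kind G)) (lo G) i
                   ∷ gap (rightPart (kind G)) (suc (lo G + i)) j
                   ∷ (gs ─ p)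

module _ {n os gs} (inv : Gaps n os gs) where
  open Gaps inv

  ∈os⇒<n : ∀ {x} → x ∈ os → x < n
  ∈os⇒<n {x} x∈ = χ-inside⁻ (subst (1 ≤_) (tiling x) (≤-trans (∈⇒multiplicity x∈) (m≤n+m _ _)))

  χ-positive : ∀ {G x} → G ∈ gs → 1 ≤ χ (lo G) (len G) x → x < n × x ∉ os
  χ-positive {G} {x} G∈ pos =
    χ-inside⁻ (subst (1 ≤_) (tiling x) (≤-trans covered (m≤m+n _ _))) ,
    -- A place both in a gap and taken would be counted twice by `tiling`.
    λ x∈ → <⇒≱ (n<1+n 1) (≤-trans (+-mono-≤ covered (∈⇒multiplicity x∈))
                                    (subst (_≤ 1) (sym (tiling x)) (χ≤1 0 n x)))
    where
    covered : 1 ≤ total (λ G → χ (lo G) (len G) x) gs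
    covered = ≤-trans pos (∈⇒≤total (λ G → χ (lo G) (len G) x) G∈)

  cell : ∀ {G} i j → G ∈ gs → len G ≡ suc (i + j) → lo G + i < n × lo G + i ∉ os
  cell {G} i j G∈ eq = χ-positive G∈ (subst (λ l → 1 ≤ χ (lo G) l (lo G + i)) (sym eq) (χ-hit (lo G) i j))

  locate : ∀ {x} → x < n → x ∉ os → ∃ λ G → ∃₂ λ i j → G ∈ gs × x ≡ lo G + i × len G ≡ suc (i + j)
  locate {x} x<n x∉ with total-positive (λ G → χ (lo G) (len G) x) gs
    (≤-reflexive (sym (trans (sym (+-identityʳ _))
      (trans (cong (total _ gs +_) (sym (∉⇒multiplicity x∉))) (trans (tiling x) (χ-inside x<n))))))
  ... | G , G∈ , pos = let i , j , p , q = χ-∈ (lo G) (len G) x pos in G , i , j , G∈ , p , q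

  outside : ∀ {G y} → G ∈ gs → y ∈ os → y < lo G ⊎ lo G + len G ≤ y
  outside {G} {y} G∈ y∈ with y <? lo G | lo G + len G ≤? y
  ... | yes p | _     = inj₁ p
  ... | no  _ | yes q = inj₂ q
  ... | no ¬p | no ¬q = ⊥-elim (proj₂ (cell i j G∈ len≡) (subst (_∈ os) (sym y≡) y∈))
    where
    i = y ∸ lo G
    j = len G ∸ suc i
    y≡ : lo G + i ≡ y
    y≡ = m+[n∸m]≡n (≮⇒≥ ¬p)
    len≡ : len G ≡ suc (i + j)
    len≡ = sym (m+[n∸m]≡n (+-cancelˡ-< (lo G) i (len G) (subst (_< lo G + len G) (sym y≡) (≰⇒> ¬q))))

  -- By `χ-split` the old interval is the sum of the two new intervals and the point just taken;
  -- that point moves from the gaps' share of `tiling` to the seats' share.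
  split-gaps : ∀ {G} i j (p : G ∈ gs) → len G ≡ suc (i + j) → Gaps n (lo G + i ∷ os) (split gs p i j)
  split-gaps {gap κ l _} i j p refl = record
    { bounded = (proj₁ (parts κ here-bounded) , proj₂ (parts κ here-bounded))
              ∷ (proj₁ (parts′ κ here-bounded) , proj₂ (parts′ κ here-bounded))
              ∷ All.map (λ {G} → weaken (kind G) (lo G)) (All-─ p bounded)
    ; tiling  = tiling′
    }
    where
    z = l + i
    here-bounded = All.lookup bounded p
    weakenˡ : ∀ κ l → LeftBound os κ l → LeftBound (z ∷ os) κ l
    weakenˡ mid  (suc u) q = there q
    weakenˡ endR (suc u) q = there q
    weakenˡ endL l       q = q
    weakenʳ : ∀ κ h → RightBound n os κ h → RightBound n (z ∷ os) κ h
    weakenʳ mid  h q = there q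
    weakenʳ endL h q = there q
    weakenʳ endR h q = q
    weaken : ∀ κ l {h} → LeftBound os κ l × RightBound n os κ h →
             LeftBound (z ∷ os) κ l × RightBound n (z ∷ os) κ h
    weaken κ l (a , b) = weakenˡ κ l a , weakenʳ κ _ b
    hi : l + suc (i + j) ≡ suc z + j
    hi = trans (+-suc l (i + j)) (cong suc (sym (+-assoc l i j)))
    parts : ∀ κ → LeftBound os κ l × RightBound n os κ (l + suc (i + j)) →
            LeftBound (z ∷ os) (leftPart κ) l × RightBound n (z ∷ os) (leftPart κ) (l + i)
    parts mid  (a , b) = weakenˡ mid l a , here refl
    parts endL (a , b) = a , here refl
    parts endR (a , b) = weakenˡ′ l a , here refl
      where
      weakenˡ′ : ∀ l → LeftBound os endR l → LeftBound (z ∷ os) mid l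
      weakenˡ′ (suc u) q = there q
    parts′ : ∀ κ → LeftBound os κ l × RightBound n os κ (l + suc (i + j)) →
             LeftBound (z ∷ os) (rightPart κ) (suc z) × RightBound n (z ∷ os) (rightPart κ) (suc z + j)
    parts′ mid  (a , b) = here refl , there (subst (_∈ os) hi b)
    parts′ endL (a , b) = here refl , there (subst (_∈ os) hi b)
    parts′ endR (a , b) = here refl , trans (sym hi) b
    tiling′ : ∀ x → total (λ G → χ (lo G) (len G) x) (split gs p i j) + multiplicity (z ∷ os) x ≡ χ 0 n x
    tiling′ x = trans (trans (rearrange (χ l i x) (χ (suc z) j x) (total (λ G → χ (lo G) (len G) x) (gs ─ p)) (δ z x) (multiplicity os x))
      (cong (_+ multiplicity os x) (trans
        (cong (_+ total (λ G → χ (lo G) (len G) x) (gs ─ p))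
          (trans (sym (χ-split l i j x)) (cong (λ m → χ l m x) (+-suc i j))))
        (sym (total-─ (λ G → χ (lo G) (len G) x) p)))))
      (tiling x)
      where
      rearrange : ∀ a b c d e → a + (b + c) + (d + e) ≡ a + (d + b) + c + e
      rearrange = solve-∀

  -- Only the centrality of the place matters, so this applies to arrivals under either rule.
  Φ-split : ∀ {G} i j (p : G ∈ gs) → len G ≡ suc (i + j) → Central (kind G) i j → ∀ v w →
            Φ v w gs ≡ gain v w (kind G) (i + j) + Φ v w (split gs p i j)
  Φ-split {gap κ l _} i j p refl c v w = trans (total-─ _ p)
    (trans (cong (_+ Φ v w (gs ─ p)) (value-split v w κ i j c))
      (rearrange (gain v w κ (i + j)) (value v w (leftPart κ) i) (value v w (rightPart κ) j) (Φ v w (gs ─ p))))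
    where
    rearrange : ∀ a b c d → a + (b + c) + d ≡ a + (b + (c + d))
    rearrange = solve-∀

  size-split : ∀ {G} i j (p : G ∈ gs) → len G ≡ suc (i + j) →
               total len gs ≡ suc (total len (split gs p i j))
  size-split {gap κ l _} i j p refl = trans (total-─ _ p) (cong suc (+-assoc i j _))

-- Distances and neighbours inside a gap

seats : ∀ {n} → List⁺ (Fin n) → List ℕ
seats occ = map toℕ (List⁺.toList occ)

seat∈ : ∀ {n} {occ : List⁺ (Fin n)} {x} → x ∈ List⁺.toList occ → toℕ x ∈ seats occ
seat∈ = ∈-map⁺ toℕ

seat∈⁻ : ∀ {n} {occ : List⁺ (Fin n)} {x} → toℕ x ∈ seats occ → x ∈ List⁺.toList occ
seat∈⁻ x∈ with ∈-map⁻ toℕ x∈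
... | y , y∈ , eq = subst (_∈ _) (sym (toℕ-injective eq)) y∈

module _ {n : ℕ} where

  taken? : ∀ (occ : List⁺ (Fin n)) y → Dec (y ∈ List⁺.toList occ)
  taken? occ y = Any.any? (y ≟ᶠ_) (List⁺.toList occ)

  distance-≤ : ∀ (occ : List⁺ (Fin n)) x {y} → toℕ y ∈ seats occ → distance occ x ≤ ∣ toℕ x - toℕ y ∣
  distance-≤ (y ∷ ys) x y∈ = go y ys (seat∈⁻ {occ = y ∷ ys} y∈)
    where
    go : ∀ y ys {z} → z ∈ y ∷ ys → distance (y ∷ ys) x ≤ ∣ toℕ x - toℕ z ∣
    go y []        (here refl) = ≤-refl
    go y (y′ ∷ ys) (here refl) = m⊓n≤m _ _
    go y (y′ ∷ ys) (there z∈)  = ≤-trans (m⊓n≤n _ _) (go y′ ys z∈)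

  ≤-distance : ∀ (occ : List⁺ (Fin n)) x {m} → (∀ {y} → y ∈ seats occ → m ≤ ∣ toℕ x - y ∣) → m ≤ distance occ x
  ≤-distance (y ∷ ys) x {m} = go y ys
    where
    go : ∀ y ys → (∀ {z} → z ∈ map toℕ (y ∷ ys) → m ≤ ∣ toℕ x - z ∣) → m ≤ distance (y ∷ ys) x
    go y []        far = far (here refl)
    go y (y′ ∷ ys) far = ⊓-glb (far (here refl)) (go y′ ys (far ∘ there))

  occupiedNeighbours-sum : ∀ (occ : List⁺ (Fin n)) x → occupiedNeighbours occ x ≡
    total (λ y → δ (suc (toℕ y)) (toℕ x) * ind (taken? occ y)) (allFin n) +
    total (λ y → δ (toℕ y) (suc (toℕ x)) * ind (taken? occ y)) (allFin n)
  occupiedNeighbours-sum occ x = trans (length-filter-total _ (allFin n))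
    (trans (total-cong pointwise (allFin n)) (total-+ _ _ (allFin n)))
    where
    adjacent : ∀ a b → ind (∣ a - b ∣ ≟ 1) ≡ δ (suc b) a + δ b (suc a)
    adjacent zero    zero          = refl
    adjacent zero    (suc zero)    = refl
    adjacent zero    (suc (suc b)) = refl
    adjacent (suc zero)    zero = refl
    adjacent (suc (suc a)) zero = refl
    adjacent (suc a) (suc b)    = adjacent a b
    pointwise : ∀ y → _
    pointwise y = trans (ind-× (∣ toℕ x - toℕ y ∣ ≟ 1) (taken? occ y))
      (trans (cong (_* ind (taken? occ y)) (adjacent (toℕ x) (toℕ y)))
             (*-distribʳ-+ (ind (taken? occ y)) (δ (suc (toℕ y)) (toℕ x)) _))

  neighbour-taken : ∀ (occ : List⁺ (Fin n)) {f : ℕ → ℕ} {a} → (∀ y → f y ≡ δ a y) → a ∈ seats occ →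
    total (λ y → f (toℕ y) * ind (taken? occ y)) (allFin n) ≡ 1
  neighbour-taken occ {f} {a} f≗ a∈ with ∈-map⁻ toℕ a∈
  ... | b , b∈ , refl = trans (total-cong pointwise (allFin n)) (total-δ (toℕ<n b))
    where
    pointwise : ∀ y → f (toℕ y) * ind (taken? occ y) ≡ δ (toℕ b) (toℕ y)
    pointwise y with b ≟ᶠ y
    ... | yes refl = trans (cong (f (toℕ y) *_) (ind-yes (taken? occ y) b∈))
                           (trans (*-identityʳ _) (f≗ (toℕ y)))
    ... | no  b≢y  = trans (cong (_* ind (taken? occ y))
                              (trans (f≗ (toℕ y)) δ≡0)) (sym δ≡0)
      where
      δ≡0 : δ (toℕ b) (toℕ y) ≡ 0
      δ≡0 = δ-≢ (b≢y ∘ toℕ-injective)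

  neighbour-free : ∀ (occ : List⁺ (Fin n)) {f : ℕ → ℕ} → (∀ {y} → y ∈ seats occ → f y ≡ 0) →
    total (λ y → f (toℕ y) * ind (taken? occ y)) (allFin n) ≡ 0
  neighbour-free occ {f} f≗0 = total-zero (allFin n) λ {y} _ → pointwise y
    where
    pointwise : ∀ y → f (toℕ y) * ind (taken? occ y) ≡ 0
    pointwise y with taken? occ y
    ... | yes y∈ = cong (_* ind (taken? occ y)) (f≗0 (seat∈ {occ = occ} y∈))
    ... | no  y∉ = trans (cong (f (toℕ y) *_) (ind-no (taken? occ y) y∉)) (*-zeroʳ (f (toℕ y)))

far-left : ∀ l i {y} → y < l → suc i ≤ ∣ l + i - y ∣
far-left l i {y} y<l = ≤-trans (m+n≤o⇒m≤o∸n (suc i) (≤-trans (≤-reflexive (cong suc (+-comm i y))) (+-monoˡ-≤ i y<l)))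
                               (m∸n≤∣m-n∣ (l + i) y)

far-right : ∀ l i j {y} → l + suc (i + j) ≤ y → suc j ≤ ∣ l + i - y ∣
far-right l i j {y} hi≤y = ≤-trans
  (m+n≤o⇒m≤o∸n (suc j) (≤-trans (≤-reflexive (trans (+-comm (suc j) (l + i)) (trans (+-assoc l i (suc j)) (cong (l +_) (+-suc i j))))) hi≤y))
  (subst (y ∸ (l + i) ≤_) (∣-∣-comm y (l + i)) (m∸n≤∣m-n∣ y (l + i)))

at-left : ∀ u i → ∣ suc u + i - u ∣ ≡ suc i
at-left u i = trans (cong (λ m → ∣ m - u ∣) (sym (+-suc u i)))
                    (trans (∣-∣-comm (u + suc i) u) (∣m-m+n∣≡n u (suc i)))

at-right : ∀ l i j → ∣ l + i - l + suc (i + j) ∣ ≡ suc j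
at-right l i j = trans (cong (λ m → ∣ l + i - m ∣) (trans (cong (l +_) (sym (+-suc i j))) (sym (+-assoc l i (suc j)))))
                       (∣m-m+n∣≡n (l + i) (suc j))

module _ {n : ℕ} {occ : List⁺ (Fin n)} {gs} (inv : Gaps n (seats occ) gs) where
  open Gaps inv

  distance-≤′ : ∀ x {y} → y ∈ seats occ → distance occ x ≤ ∣ toℕ x - y ∣
  distance-≤′ x y∈ with ∈-map⁻ toℕ y∈
  ... | b , b∈ , refl = distance-≤ occ x (seat∈ {occ = occ} b∈)

  -- The walls are seats, which gives the upper bound. Every seat lies outside the gap, hence no
  -- nearer than a wall on its side, which gives the lower bound; on the open side of an end gap
  -- there is no seat at all.
  distance-in-gap : ∀ {G} i j x → G ∈ gs → len G ≡ suc (i + j) → toℕ x ≡ lo G + i →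
                    distance occ x ≡ dist (kind G) i j
  distance-in-gap {gap κ l _} i j x G∈ refl x≡ =
    ≤-antisym (upper κ l G∈ x≡ (All.lookup bounded G∈)) (≤-distance occ x (lower κ l G∈ x≡ (All.lookup bounded G∈)))
    where
    upper : ∀ κ l → gap κ l (suc (i + j)) ∈ gs → toℕ x ≡ l + i → Bounded n (seats occ) (gap κ l (suc (i + j))) → distance occ x ≤ dist κ i j
    lower : ∀ κ l → gap κ l (suc (i + j)) ∈ gs → toℕ x ≡ l + i → Bounded n (seats occ) (gap κ l (suc (i + j))) →
            ∀ {y} → y ∈ seats occ → dist κ i j ≤ ∣ toℕ x - y ∣
    upperʳ : ∀ l → toℕ x ≡ l + i → l + suc (i + j) ∈ seats occ → distance occ x ≤ suc j
    upperʳ l x≡ b = ≤-trans (distance-≤′ x b) (≤-reflexive (trans (cong (λ m → ∣ m - l + suc (i + j) ∣) x≡) (at-right l i j)))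
    upperˡ : ∀ u → toℕ x ≡ suc u + i → u ∈ seats occ → distance occ x ≤ suc i
    upperˡ u x≡ b = ≤-trans (distance-≤′ x b) (≤-reflexive (trans (cong (λ m → ∣ m - u ∣) x≡) (at-left u i)))
    upper mid  (suc u) G∈ x≡ (a , b) = ⊓-glb (upperˡ u x≡ a) (upperʳ (suc u) x≡ b)
    upper endL l       G∈ x≡ (a , b) = upperʳ l x≡ b
    upper endR (suc u) G∈ x≡ (a , b) = upperˡ u x≡ a
    lower κ l G∈ x≡ bd {y} y∈ rewrite x≡ with outside inv G∈ y∈
    lower mid  l G∈ x≡ bd {y} y∈ | inj₁ p = ≤-trans (s≤s (m⊓n≤m i j)) (far-left l i p)
    lower mid  l G∈ x≡ bd {y} y∈ | inj₂ p = ≤-trans (s≤s (m⊓n≤n i j)) (far-right l i j p)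
    lower endL l G∈ x≡ (refl , _) {y} y∈ | inj₁ ()
    lower endL l G∈ x≡ bd {y} y∈ | inj₂ p = far-right l i j p
    lower endR l G∈ x≡ bd {y} y∈ | inj₁ p = far-left l i p
    lower endR l G∈ x≡ (_ , b) {y} y∈ | inj₂ p = ⊥-elim (<⇒≱ (∈os⇒<n inv y∈) (subst (_≤ y) b p))

  -- An adjacent place inside the gap is empty, one at a wall is taken, and beyond an end of the row
  -- there is none.
  neighbours-in-gap : ∀ {G} i j x → G ∈ gs → len G ≡ suc (i + j) → toℕ x ≡ lo G + i →
                      occupiedNeighbours occ x ≡ nbrs (kind G) i j
  neighbours-in-gap {gap κ l _} i j x G∈ refl x≡ =
    trans (occupiedNeighbours-sum occ x) (go κ l G∈ x≡ (All.lookup bounded G∈))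
    where
    leftSum rightSum : ℕ
    leftSum  = total (λ y → δ (suc (toℕ y)) (toℕ x) * ind (taken? occ y)) (allFin n)
    rightSum = total (λ y → δ (toℕ y) (suc (toℕ x)) * ind (taken? occ y)) (allFin n)
    δ-sym : ∀ a b → δ a b ≡ δ b a
    δ-sym a b = ind-⇔ (a ≟ b) (b ≟ a) sym sym
    leftTaken : ∀ {u} → u ∈ seats occ → suc u ≡ toℕ x → leftSum ≡ 1
    leftTaken {u} u∈ eq = neighbour-taken occ {f = λ y → δ (suc y) (toℕ x)}
      (λ y → trans (cong (δ (suc y)) (sym eq)) (δ-sym y u)) u∈
    leftFree : (∀ {y} → y ∈ seats occ → suc y ≢ toℕ x) → leftSum ≡ 0
    leftFree free = neighbour-free occ {f = λ y → δ (suc y) (toℕ x)} (λ y∈ → δ-≢ (free y∈))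
    rightTaken : suc (toℕ x) ∈ seats occ → rightSum ≡ 1
    rightTaken x∈ = neighbour-taken occ {f = λ y → δ y (suc (toℕ x))} (λ y → δ-sym y _) x∈
    rightFree : (∀ {y} → y ∈ seats occ → y ≢ suc (toℕ x)) → rightSum ≡ 0
    rightFree free = neighbour-free occ {f = λ y → δ y (suc (toℕ x))} (λ y∈ → δ-≢ (free y∈))
    leftInner : ∀ {κ l i′} → i ≡ suc i′ → gap κ l (suc (i + j)) ∈ gs → toℕ x ≡ l + i → leftSum ≡ 0
    leftInner {l = l} {i′} i≡ G∈ x≡ = leftFree λ y∈ eq →
      proj₂ (cell inv i′ (suc j) G∈ (cong suc (trans (cong (_+ j) i≡) (sym (+-suc i′ j)))))
        (subst (_∈ seats occ) (suc-injective (trans eq (trans x≡ (trans (cong (l +_) i≡) (+-suc l i′))))) y∈)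
    rightInner : ∀ {κ l j′} → j ≡ suc j′ → gap κ l (suc (i + j)) ∈ gs → toℕ x ≡ l + i → rightSum ≡ 0
    rightInner {l = l} {j′} j≡ G∈ x≡ = rightFree λ y∈ eq →
      proj₂ (cell inv (suc i) j′ G∈ (cong suc (trans (cong (i +_) j≡) (+-suc i j′))))
        (subst (_∈ seats occ) (trans eq (trans (cong suc x≡) (sym (+-suc l i)))) y∈)
    next : ∀ {l} → j ≡ 0 → toℕ x ≡ l + i → l + suc (i + j) ≡ suc (toℕ x)
    next {l} j≡ x≡ = trans (+-suc l (i + j))
      (cong suc (trans (cong (l +_) (trans (cong (i +_) j≡) (+-identityʳ i))) (sym x≡)))
    leftWall : ∀ κ u → gap κ (suc u) (suc (i + j)) ∈ gs → toℕ x ≡ suc u + i → u ∈ seats occ → leftSum ≡ δ i 0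
    leftWall κ u G∈ x≡ a = by-cases i refl
      where
      by-cases : ∀ m → i ≡ m → leftSum ≡ δ m 0
      by-cases zero     i≡ = leftTaken a (sym (trans x≡ (trans (cong (suc u +_) i≡) (+-identityʳ (suc u)))))
      by-cases (suc i′) i≡ = leftInner i≡ G∈ x≡
    rightWall : ∀ κ l → gap κ l (suc (i + j)) ∈ gs → toℕ x ≡ l + i → l + suc (i + j) ∈ seats occ → rightSum ≡ δ j 0
    rightWall κ l G∈ x≡ b = by-cases j refl
      where
      by-cases : ∀ m → j ≡ m → rightSum ≡ δ m 0
      by-cases zero     j≡ = rightTaken (subst (_∈ seats occ) (next j≡ x≡) b)
      by-cases (suc j′) j≡ = rightInner j≡ G∈ x≡
    go : ∀ κ l → gap κ l (suc (i + j)) ∈ gs → toℕ x ≡ l + i → Bounded n (seats occ) (gap κ l (suc (i + j))) →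
         leftSum + rightSum ≡ nbrs κ i j
    go mid  (suc u) G∈ x≡ (a , b) = cong₂ _+_ (leftWall mid u G∈ x≡ a) (rightWall mid (suc u) G∈ x≡ b)
    go endL l G∈ x≡ (refl , b) = trans (cong (_+ rightSum) (noLeft i refl)) (rightWall endL 0 G∈ x≡ b)
      where
      noLeft : ∀ m → i ≡ m → leftSum ≡ 0
      noLeft zero     i≡ = leftFree λ _ eq → contradiction (trans eq (trans x≡ i≡)) λ ()
      noLeft (suc i′) i≡ = leftInner i≡ G∈ x≡
    go endR (suc u) G∈ x≡ (a , b) = trans (cong (leftSum +_) (noRight j refl))
      (trans (+-identityʳ leftSum) (leftWall endR u G∈ x≡ a))
      where
      noRight : ∀ m → j ≡ m → rightSum ≡ 0
      noRight zero     j≡ = rightFree λ y∈ eq → <⇒≢ (∈os⇒<n inv y∈) (trans eq (trans (sym (next j≡ x≡)) b))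
      noRight (suc j′) j≡ = rightInner j≡ G∈ x≡

-- The gaps at the arrival of a person

∈-─ : ∀ {X : Set} {x y : X} {xs} (p : x ∈ xs) → y ∈ xs → y ≡ x ⊎ y ∈ (xs ─ p)
∈-─ (here refl) (here refl) = inj₁ refl
∈-─ (here refl) (there q)   = inj₂ q
∈-─ (there p)   (here refl) = inj₂ (here refl)
∈-─ (there p)   (there q) with ∈-─ p q
... | inj₁ eq = inj₁ eq
... | inj₂ r  = inj₂ (there r)

infix 4 _∈cells_
record _∈cells_ (x : ℕ) (G : Gap) : Set where
  constructor cellAt
  field
    before after : ℕ
    position     : x ≡ lo G + before
    extent       : len G ≡ suc (before + after)
open _∈cells_

elsewhere : ∀ {n os gs} → Gaps n os gs → ∀ {G H x} (G∈ : G ∈ gs) → x ∈cells G → H ∈ (gs ─ G∈) → ¬ x ∈cells H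
elsewhere {n} {os} {gs} inv {G} {H} {x} G∈ (cellAt i j p eq) H∈ (cellAt i′ j′ p′ eq′) =
  <⇒≱ (n<1+n 1) (≤-trans
    (subst (2 ≤_) (sym (total-─ covers G∈)) (+-mono-≤ (covered G i j p eq)
      (≤-trans (covered H i′ j′ p′ eq′) (∈⇒≤total covers H∈))))
    (≤-trans (m≤m+n _ _) (subst (_≤ 1) (sym (Gaps.tiling inv x)) (χ≤1 0 n x))))
  where
  covers : Gap → ℕ
  covers G = χ (lo G) (len G) x
  covered : ∀ G i j → x ≡ lo G + i → len G ≡ suc (i + j) → 1 ≤ covers G
  covered G i j p eq = subst₂ (λ l y → 1 ≤ χ (lo G) l y) (sym eq) (sym p) (χ-hit (lo G) i j)

same-gap : ∀ {n os gs} → Gaps n os gs → ∀ {G H x} → G ∈ gs → H ∈ gs → x ∈cells G → x ∈cells H → H ≡ G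
same-gap inv G∈ H∈ c c′ with ∈-─ G∈ H∈
... | inj₁ H≡G = H≡G
... | inj₂ H∈′ = ⊥-elim (elsewhere inv G∈ c H∈′ c′)

total-len-zero : ∀ v w gs → total len gs ≡ 0 → Φ v w gs ≡ 0
total-len-zero v w gs eq = total-zero gs λ {G} G∈ →
  trans (cong (value v w (kind G)) (n≤0⇒n≡0 (subst (len G ≤_) eq (∈⇒≤total len G∈)))) (value-zero v w (kind G))

Paired : ∀ {n} → ℕ → List⁺ (Fin n) → Fin n → Fin n → Set
Paired k occ x y = (Empty occ x × distance occ x ≡ k) × (Empty occ y × distance occ y ≡ k)

module _ {n} {occ : List⁺ (Fin n)} {gs} (inv : Gaps n (seats occ) gs) where

  place : ∀ {x} → Empty occ x → ∃ λ G → G ∈ gs × toℕ x ∈cells G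
  place {x} x∉ with locate inv (toℕ<n x) (x∉ ∘ seat∈⁻ {occ = occ})
  ... | G , i , j , G∈ , p , q = G , G∈ , cellAt i j p q

  cell-place : ∀ {G} i j → G ∈ gs → len G ≡ suc (i + j) → ∃ λ x → Empty occ x × toℕ x ≡ lo G + i
  cell-place {G} i j G∈ eq = let lt , ∉os = cell inv i j G∈ eq in
    fromℕ< lt , (λ x∈ → ∉os (subst (_∈ seats occ) (toℕ-fromℕ< lt) (seat∈ {occ = occ} x∈))) , toℕ-fromℕ< lt

  centre-place : ∀ {G m} → G ∈ gs → len G ≡ suc m → ∃ λ x → ∃₂ λ i j →
                 Empty occ x × toℕ x ≡ lo G + i × i + j ≡ m × Central (kind G) i j
  centre-place {G} {m} G∈ eq with m+[n∸m]≡n (centre₁≤ (kind G) m)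
  ... | i+j≡m with cell-place (centre₁ (kind G) m) _ G∈ (trans eq (cong suc (sym i+j≡m)))
  ... | x , x∉ , p = x , centre₁ (kind G) m , _ , x∉ , p , i+j≡m , inj₁ (cong (centre₁ (kind G)) (sym i+j≡m))

  -- Comparing `x` with a centre of its own gap suffices: a distance maximal in the whole row is
  -- maximal within the gap.
  basic⇒central : ∀ {x G} → BasicRule occ x → G ∈ gs → (c : toℕ x ∈cells G) → Central (kind G) (before c) (after c)
  basic⇒central {x} {G} (x∉ , best) G∈ (cellAt i j p eq) with centre-place G∈ eq
  ... | y , a , b , y∉ , q , a+b≡m , central =
    dist-maximal⇒central (kind G) i j (subst₂ _≤_
      (trans (distance-in-gap inv a b y G∈ (trans eq (cong suc (sym a+b≡m))) q)
        (trans (central⇒dist-maximal (kind G) a b central) (cong (radius (kind G)) a+b≡m)))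
      (distance-in-gap inv i j x G∈ eq p) (best y y∉))

  after-seat : ∀ {x G} (G∈ : G ∈ gs) (c : toℕ x ∈cells G) → Gaps n (seats (x ∷⁺ occ)) (split gs G∈ (before c) (after c))
  after-seat G∈ (cellAt i j p eq) = subst (λ y → Gaps n (y ∷ seats occ) (split gs G∈ i j)) (sym p)
                                          (split-gaps inv i j G∈ eq)

  -- In an inner gap with `i` places before `x` and `j` after `y`, equal distances mean that
  -- `i ⊓ suc j` and `suc i ⊓ j` agree, which forces `i` and `j` to be equal. In an end gap the two
  -- distances differ by one.
  paired⇒even-gap : ∀ {k x y} → toℕ y ≡ suc (toℕ x) → Paired k occ x y →
                    ∃₂ λ l h → k ≡ suc h × gap mid l (suc (h + suc h)) ∈ gs × toℕ x ≡ l + h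
  paired⇒even-gap {k} {x} {y} y≡ ((x∉ , dx) , (y∉ , dy)) with place x∉
  -- With no place of the gap after `x`, the place `y` would be a seat or lie beyond the row.
  ... | gap κ l _ , G∈ , cellAt i zero p refl = ⊥-elim (blocked κ (proj₂ (All.lookup (Gaps.bounded inv) G∈)))
    where
    hi≡ : l + suc (i + 0) ≡ toℕ y
    hi≡ = trans (+-suc l (i + 0)) (trans (cong (λ a → suc (l + a)) (+-identityʳ i)) (trans (cong suc (sym p)) (sym y≡)))
    blocked : ∀ κ → ¬ RightBound n (seats occ) κ (l + suc (i + 0))
    blocked mid  b = y∉ (seat∈⁻ {occ = occ} (subst (_∈ seats occ) hi≡ b))
    blocked endL b = y∉ (seat∈⁻ {occ = occ} (subst (_∈ seats occ) hi≡ b))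
    blocked endR b = <⇒≢ (toℕ<n y) (trans (sym hi≡) b)
  ... | gap κ l _ , G∈ , cellAt i (suc j) p refl = go κ G∈
    (trans (sym (distance-in-gap inv i (suc j) x G∈ refl p)) dx)
    (trans (sym (distance-in-gap inv (suc i) j y G∈ (cong suc (+-suc i j))
      (trans y≡ (trans (cong suc p) (sym (+-suc l i)))))) dy)
    where
    go : ∀ κ → gap κ l (suc (i + suc j)) ∈ gs → dist κ i (suc j) ≡ k → dist κ (suc i) j ≡ k →
         ∃₂ λ l h → k ≡ suc h × gap mid l (suc (h + suc h)) ∈ gs × toℕ x ≡ l + h
    go mid G∈ d e with ≤-total i j
    ... | inj₁ i≤j with ⊓-sel (suc i) j | trans (suc-injective (trans e (sym d))) (m≤n⇒m⊓n≡m (m≤n⇒m≤1+n i≤j))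
    ...   | inj₁ q | r = contradiction (trans (sym q) r) 1+n≢n
    ...   | inj₂ q | r with trans (sym q) r
    ...     | refl = l , i , trans (sym d) (cong suc (m≤n⇒m⊓n≡m (n≤1+n i))) , G∈ , p
    go mid G∈ d e | inj₂ j≤i with ⊓-sel i (suc j) | trans (suc-injective (trans d (sym e))) (m≥n⇒m⊓n≡n (m≤n⇒m≤1+n j≤i))
    ...   | inj₂ q | r = contradiction (trans (sym q) r) 1+n≢n
    ...   | inj₁ q | r with trans (sym q) r
    ...     | refl = l , i , trans (sym d) (cong suc (m≤n⇒m⊓n≡m (n≤1+n i))) , G∈ , p
    go endL G∈ d e = contradiction (suc-injective (trans d (sym e))) 1+n≢n
    go endR G∈ d e = contradiction (suc-injective (trans e (sym d))) 1+n≢n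

-- Fillings from the left

-- `m` is a length minus one. An inner gap has two middle places, both at distance `k`, exactly when
-- its length is `k + k`; an end gap never has two.
personsMid personsEnd pairsMid pairsEnd : ℕ → ℕ → ℕ
personsMid k m = δ (suc ⌊ m /2⌋) k
personsEnd k m = δ (suc m) k
pairsMid k m = δ (suc m) (k + k)
pairsEnd k m = 0

personsAt : ∀ {n} → ℕ → List⁺ (Fin n) → List (Fin n) → ℕ
personsAt k occ xs = total (λ (o , x) → ind (distance o x ≟ k)) (arrivalsAfter occ xs)

personsAt-Φ : ∀ {n} k occ (xs : List (Fin n)) {gs} → Gaps n (seats occ) gs → total len gs ≡ length xs →
              All (uncurry BasicRule) (arrivalsAfter occ xs) → personsAt k occ xs ≡ Φ (personsMid k) (personsEnd k) gs
personsAt-Φ k occ []       {gs} inv size []           = sym (total-len-zero (personsMid k) (personsEnd k) gs size)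
personsAt-Φ k occ (x ∷ xs) {gs} inv size (rule ∷ rules) with place inv (proj₁ rule)
... | G , G∈ , c@(cellAt i j p eq) = begin
  ind (distance occ x ≟ k) + personsAt k (x ∷⁺ occ) xs
    ≡⟨ cong₂ (λ d q → ind (d ≟ k) + q) distance≡ (personsAt-Φ k (x ∷⁺ occ) xs (after-seat inv G∈ c) size′ rules) ⟩
  δ (radius (kind G) (i + j)) k + Φ (personsMid k) (personsEnd k) (split gs G∈ i j)
    ≡⟨ cong (_+ Φ (personsMid k) (personsEnd k) (split gs G∈ i j)) (radius-gain (kind G)) ⟩
  gain (personsMid k) (personsEnd k) (kind G) (i + j) + Φ (personsMid k) (personsEnd k) (split gs G∈ i j)
    ≡⟨ Φ-split inv i j G∈ eq central (personsMid k) (personsEnd k) ⟨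
  Φ (personsMid k) (personsEnd k) gs ∎
  where
  open ≡-Reasoning
  central : Central (kind G) i j
  central = basic⇒central inv rule G∈ c
  distance≡ : distance occ x ≡ radius (kind G) (i + j)
  distance≡ = trans (distance-in-gap inv i j x G∈ eq p) (central⇒dist-maximal (kind G) i j central)
  size′ : total len (split gs G∈ i j) ≡ length xs
  size′ = suc-injective (trans (sym (size-split inv i j G∈ eq)) size)
  radius-gain : ∀ κ → δ (radius κ (i + j)) k ≡ gain (personsMid k) (personsEnd k) κ (i + j)
  radius-gain mid  = refl
  radius-gain endL = refl
  radius-gain endR = refl

Steps : ℕ → Set
Steps n = List (List⁺ (Fin n) × Fin n)

-- `IsPairAtDistance` with the list of steps as a parameter, so that an induction can pass to the
-- later steps.
PairIn : ∀ {n} → ℕ → Steps n → Fin n × Fin n → Set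
PairIn k steps (x , y) = toℕ y ≡ suc (toℕ x) × Any (λ (occ , _) → Paired k occ x y) steps

paired? : ∀ {n} k (occ : List⁺ (Fin n)) x y → Dec (Paired k occ x y)
paired? k occ x y = (empty? occ x ×-dec (distance occ x ≟ k)) ×-dec (empty? occ y ×-dec (distance occ y ≟ k))

pairIn? : ∀ {n} k (steps : Steps n) xy → Dec (PairIn k steps xy)
pairIn? k steps (x , y) = (toℕ y ≟ suc (toℕ x)) ×-dec Any.any? (λ (occ , _) → paired? k occ x y) steps

allPairs : ∀ n → List (Fin n × Fin n)
allPairs n = cartesianProduct (allFin n) (allFin n)

total-δ-pair : ∀ {n a b} → a < n → b < n →
               total (λ (x , y) → δ a (toℕ x) * δ b (toℕ y)) (allPairs n) ≡ 1
total-δ-pair {n} {a} {b} a<n b<n = begin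
  total (λ (x , y) → δ a (toℕ x) * δ b (toℕ y)) (allPairs n)
    ≡⟨ total-product _ _,_ (allFin n) (allFin n) ⟩
  total (λ x → total (λ y → δ a (toℕ x) * δ b (toℕ y)) (allFin n)) (allFin n)
    ≡⟨ total-cong (λ x → trans (total-* (δ a (toℕ x)) _ (allFin n))
         (trans (cong (δ a (toℕ x) *_) (total-δ b<n)) (*-identityʳ _))) (allFin n) ⟩
  total (λ x → δ a (toℕ x)) (allFin n)
    ≡⟨ total-δ a<n ⟩
  1 ∎
  where open ≡-Reasoning

half-odd : ∀ h → ⌊ h + suc h /2⌋ ≡ h
half-odd h = trans (cong ⌊_/2⌋ (+-suc h h)) (sym (n≡⌈n+n/2⌉ h))

half-odd′ : ∀ h → ⌈ h + suc h /2⌉ ≡ suc h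
half-odd′ h = trans (cong ⌈_/2⌉ (+-suc h h)) (cong suc (sym (n≡⌊n+n/2⌋ h)))

module _ {n} {occ : List⁺ (Fin n)} {gs} (inv : Gaps n (seats occ) gs) where

  cell-empty : ∀ {G x} i j → G ∈ gs → len G ≡ suc (i + j) → toℕ x ≡ lo G + i → Empty occ x
  cell-empty i j G∈ eq p x∈ = proj₂ (cell inv i j G∈ eq) (subst (_∈ seats occ) p (seat∈ {occ = occ} x∈))

  even-gap⇒paired : ∀ {l h x y} → gap mid l (suc (h + suc h)) ∈ gs → toℕ x ≡ l + h → toℕ y ≡ suc (toℕ x) →
                    Paired (suc h) occ x y
  even-gap⇒paired {l} {h} {x} {y} G∈ p y≡ =
    (cell-empty h (suc h) G∈ refl p ,
     trans (distance-in-gap inv h (suc h) x G∈ refl p) (cong suc (m≤n⇒m⊓n≡m (n≤1+n h)))) ,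
    (cell-empty (suc h) h G∈ eq q ,
     trans (distance-in-gap inv (suc h) h y G∈ eq q) (cong suc (m≥n⇒m⊓n≡n (n≤1+n h))))
    where
    eq : suc (h + suc h) ≡ suc (suc h + h)
    eq = cong suc (+-suc h h)
    q : toℕ y ≡ l + suc h
    q = trans y≡ (trans (cong suc p) (sym (+-suc l h)))

-- A pair can be seen at many times but must be counted once. It is charged to the step at which one
-- of its places is taken: afterwards it is not seen, and before that its gap stays intact, so a
-- pair visible now is either charged to this step or visible at the next.
pairIn-Φ : ∀ {n} k occ (xs : List (Fin n)) {gs} → Gaps n (seats occ) gs → total len gs ≡ length xs →
           All (uncurry BasicRule) (arrivalsAfter occ xs) →
           total (λ xy → ind (pairIn? k (arrivalsAfter occ xs) xy)) (allPairs n) ≡ Φ (pairsMid k) (pairsEnd k) gs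
pairIn-Φ {n} k occ [] {gs} inv size [] =
  trans (total-zero (allPairs n) λ {xy} _ → ind-no (pairIn? k [] xy) λ ()) (sym (total-len-zero (pairsMid k) (pairsEnd k) gs size))
pairIn-Φ {n} k occ (z ∷ xs) {gs} inv size (rule ∷ rules) with place inv (proj₁ rule)
... | G , G∈ , c@(cellAt i j p eq) = begin
  total (λ xy → ind (pairIn? k steps xy)) (allPairs n)
    ≡⟨ total-cong pointwise (allPairs n) ⟩
  total (λ xy → γ * central-pair xy + ind (pairIn? k rest xy)) (allPairs n)
    ≡⟨ total-+ (λ xy → γ * central-pair xy) _ (allPairs n) ⟩
  total (λ xy → γ * central-pair xy) (allPairs n) + total (λ xy → ind (pairIn? k rest xy)) (allPairs n)
    ≡⟨ cong₂ _+_ (trans (total-* γ central-pair (allPairs n)) one-pair) (pairIn-Φ k (z ∷⁺ occ) xs inv′ size′ rules) ⟩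
  γ + Φ (pairsMid k) (pairsEnd k) (split gs G∈ i j)
    ≡⟨ Φ-split inv i j G∈ eq central (pairsMid k) (pairsEnd k) ⟨
  Φ (pairsMid k) (pairsEnd k) gs ∎
  where
  open ≡-Reasoning
  steps rest : Steps n
  steps = arrivalsAfter occ (z ∷ xs)
  rest  = arrivalsAfter (z ∷⁺ occ) xs
  m a γ : ℕ
  m = i + j
  a = lo G + ⌊ m /2⌋
  γ = gain (pairsMid k) (pairsEnd k) (kind G) m
  central-pair : Fin n × Fin n → ℕ
  central-pair (x , y) = δ a (toℕ x) * δ (suc a) (toℕ y)
  central : Central (kind G) i j
  central = basic⇒central inv rule G∈ c
  inv′ : Gaps n (seats (z ∷⁺ occ)) (split gs G∈ i j)
  inv′ = after-seat inv G∈ c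
  size′ : total len (split gs G∈ i j) ≡ length xs
  size′ = suc-injective (trans (sym (size-split inv i j G∈ eq)) size)

  even : ∀ κ → gain (pairsMid k) (pairsEnd k) κ m ≢ 0 → κ ≡ mid × ∃ λ h → k ≡ suc h × m ≡ h + suc h
  even endL γ≢0 = ⊥-elim (γ≢0 refl)
  even endR γ≢0 = ⊥-elim (γ≢0 refl)
  even mid  γ≢0 with suc m ≟ k + k
  ... | no  ne = ⊥-elim (γ≢0 (δ-≢ ne))
  ... | yes e  = refl , halves k e
    where
    halves : ∀ k → suc m ≡ k + k → ∃ λ h → k ≡ suc h × m ≡ h + suc h
    halves (suc h) e = h , refl , suc-injective e

  one-pair : γ * total central-pair (allPairs n) ≡ γ
  one-pair with γ ≟ 0
  ... | yes γ≡0 = trans (cong (_* total central-pair (allPairs n)) γ≡0) (sym γ≡0)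
  ... | no  γ≢0 with even (kind G) γ≢0
  ...   | _ , h , _ , m≡ = trans (cong (γ *_) (total-δ-pair a<n a′<n)) (*-identityʳ γ)
    where
    half : ⌊ m /2⌋ ≡ h
    half = trans (cong ⌊_/2⌋ m≡) (half-odd h)
    a<n : a < n
    a<n = subst (λ b → lo G + b < n) (sym half) (proj₁ (cell inv h (suc h) G∈ (trans eq (cong suc m≡))))
    a′<n : suc a < n
    a′<n = subst (_< n) (trans (+-suc (lo G) h) (cong (λ b → suc (lo G + b)) (sym half)))
      (proj₁ (cell inv (suc h) h G∈ (trans eq (cong suc (trans m≡ (+-suc h h))))))

  -- The pairs charged to the arrival of `z`. There is at most one, the two middle places of the gap
  -- that `z` splits, and it exists precisely when `γ` is 1.
  Split : Fin n × Fin n → Set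
  Split (x , y) = toℕ y ≡ suc (toℕ x) × Paired k occ x y × (z ≡ x ⊎ z ≡ y)

  split? : ∀ xy → Dec (Split xy)
  split? (x , y) = (toℕ y ≟ suc (toℕ x)) ×-dec paired? k occ x y ×-dec ((z ≟ᶠ x) ⊎-dec (z ≟ᶠ y))

  centre-of : ∀ {l h x y} → gap mid l (suc (h + suc h)) ≡ G → toℕ x ≡ l + h → toℕ y ≡ suc (toℕ x) →
              (a ≡ toℕ x × suc a ≡ toℕ y) × (z ≡ x ⊎ z ≡ y)
  centre-of {l} {h} {x} {y} refl px y≡ = (a≡x , trans (cong suc a≡x) (sym y≡)) , which (central-mid i j central)
    where
    m≡ : m ≡ h + suc h
    m≡ = sym (suc-injective eq)
    a≡x : a ≡ toℕ x
    a≡x = trans (cong (l +_) (trans (cong ⌊_/2⌋ m≡) (half-odd h))) (sym px)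
    which : _ → z ≡ x ⊎ z ≡ y
    which (inj₁ (q , _)) = inj₁ (toℕ-injective (trans p (trans (cong (l +_) q) a≡x)))
    which (inj₂ (q , _)) = inj₂ (toℕ-injective (trans p (trans (cong (l +_) (trans q (trans (cong ⌈_/2⌉ m≡) (half-odd′ h))))
      (trans (+-suc l h) (trans (cong suc (sym px)) (sym y≡))))))

  split⇒central : ∀ {x y} → Split (x , y) → γ ≡ 1 × a ≡ toℕ x × suc a ≡ toℕ y
  split⇒central {x} {y} (y≡ , pr , z≡) with paired⇒even-gap inv y≡ pr
  ... | l , h , refl , H∈ , px with same-gap inv G∈ H∈ c (z-cell z≡)
    where
    z-cell : z ≡ x ⊎ z ≡ y → toℕ z ∈cells gap mid l (suc (h + suc h))
    z-cell (inj₁ refl) = cellAt h (suc h) px refl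
    z-cell (inj₂ refl) = cellAt (suc h) h (trans y≡ (trans (cong suc px) (sym (+-suc l h)))) (cong suc (+-suc h h))
  ...   | refl = δ-≡ (sym eq) , proj₁ (centre-of refl px y≡)

  central⇒split : ∀ {x y} → γ ≢ 0 → a ≡ toℕ x → suc a ≡ toℕ y → Split (x , y)
  central⇒split {x} {y} γ≢0 a≡ a′≡ with even (kind G) γ≢0
  ... | κ≡ , h , refl , m≡ = y≡ , even-gap⇒paired inv H∈ px y≡ , proj₂ (centre-of G≡ px y≡)
    where
    y≡ : toℕ y ≡ suc (toℕ x)
    y≡ = trans (sym a′≡) (cong suc a≡)
    px : toℕ x ≡ lo G + h
    px = trans (sym a≡) (cong (lo G +_) (trans (cong ⌊_/2⌋ m≡) (half-odd h)))
    G≡ : gap mid (lo G) (suc (h + suc h)) ≡ G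
    G≡ = sym (cong₂ (λ κ l → gap κ (lo G) l) κ≡ (trans eq (cong suc m≡)))
    H∈ : gap mid (lo G) (suc (h + suc h)) ∈ gs
    H∈ = subst (_∈ gs) (sym G≡) G∈

  later : ∀ {x y} → toℕ y ≡ suc (toℕ x) → Paired k occ x y → ¬ (z ≡ x ⊎ z ≡ y) → PairIn k rest (x , y)
  later {x} {y} y≡ pr z≢ with paired⇒even-gap inv y≡ pr
  ... | l , h , refl , H∈ , px with ∈-─ G∈ H∈
  ...   | inj₁ H≡G = ⊥-elim (z≢ (proj₂ (centre-of H≡G px y≡)))
  -- The untouched gap is nonempty, so somebody arrives after `z`; the pair is seen just before that
  -- arrival.
  ...   | inj₂ H∈′ = y≡ , first xs (subst (1 ≤_) size′ (≤-trans z<s (∈⇒≤total len H∈″)))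
    where
    H∈″ : gap mid l (suc (h + suc h)) ∈ split gs G∈ i j
    H∈″ = there (there H∈′)
    first : ∀ xs → 1 ≤ length xs → Any _ (arrivalsAfter (z ∷⁺ occ) xs)
    first (_ ∷ _) _ = here (even-gap⇒paired inv′ H∈″ px y≡)

  pointwise : ∀ xy → ind (pairIn? k steps xy) ≡ γ * central-pair xy + ind (pairIn? k rest xy)
  pointwise (x , y) with split? (x , y)
  ... | yes s@(y≡ , pr , z≡) with split⇒central s
  ...   | γ≡1 , a≡ , a′≡ = trans (ind-yes (pairIn? k steps (x , y)) (y≡ , here pr))
    (sym (cong₂ _+_ (trans (cong₂ _*_ γ≡1 (cong₂ _*_ (δ-≡ a≡) (δ-≡ a′≡))) refl)
                    (ind-no (pairIn? k rest (x , y)) (λ (_ , q) → gone (z ∷⁺ occ) xs (here refl) z≡ q))))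
    where
    gone : ∀ o ws → z ∈ List⁺.toList o → z ≡ x ⊎ z ≡ y →
           ¬ Any (λ (occ , _) → Paired k occ x y) (arrivalsAfter o ws)
    gone o (w ∷ ws) z∈ (inj₁ refl) (here ((x∉ , _) , _)) = x∉ z∈
    gone o (w ∷ ws) z∈ (inj₂ refl) (here (_ , (y∉ , _))) = y∉ z∈
    gone o (w ∷ ws) z∈ z≡ (there q) = gone (w ∷⁺ o) ws (there z∈) z≡ q
  pointwise (x , y) | no ¬s = trans
    (ind-⇔ (pairIn? k steps (x , y)) (pairIn? k rest (x , y)) forward (λ (y≡ , q) → y≡ , there q))
    (cong (_+ ind (pairIn? k rest (x , y))) (sym vanish))
    where
    forward : PairIn k steps (x , y) → PairIn k rest (x , y)
    forward (y≡ , there q) = y≡ , q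
    forward (y≡ , here pr) = later y≡ pr λ z≡ → ¬s (y≡ , pr , z≡)
    vanish : γ * central-pair (x , y) ≡ 0
    vanish with γ ≟ 0 | a ≟ toℕ x | suc a ≟ toℕ y
    ... | yes γ≡0 | _     | _     = cong (_* central-pair (x , y)) γ≡0
    ... | no  _   | no ne | _     = trans (cong (λ d → γ * (d * δ (suc a) (toℕ y))) (δ-≢ ne)) (*-zeroʳ γ)
    ... | no  _   | yes _ | no ne = trans (cong (λ d → γ * (δ a (toℕ x) * d)) (δ-≢ ne))
                                      (trans (cong (γ *_) (*-zeroʳ (δ a (toℕ x)))) (*-zeroʳ γ))
    ... | no γ≢0  | yes e | yes f = ⊥-elim (¬s (central⇒split γ≢0 e f))

-- The extended rule and the levels of gaps

-- These are the combinations of distance and number of occupied neighbours possible for an empty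
-- place. The second criterion of the extended rule can thus decide only between the two at distance
-- 1, which is why one number can encode both criteria.
data Status : ℕ → ℕ → Set where
  apart   : ∀ d → Status (2 + d) 0
  beside  : Status 1 1
  between : Status 1 2

penalise : ℕ → ℕ → ℕ
penalise 0             d = d
penalise 1             d = d
penalise (suc (suc b)) d = 0

penalise-≤ : ∀ b d → penalise b d ≤ d
penalise-≤ 0             d = ≤-refl
penalise-≤ 1             d = ≤-refl
penalise-≤ (suc (suc b)) d = z≤n

prefer : ∀ {d b d′ b′} → Status d b → Status d′ b′ → d′ ≤ d → (d′ ≡ d → b ≤ b′) → penalise b′ d′ ≤ penalise b d
prefer {b′ = b′} (apart d) s′          d′≤d _ = ≤-trans (penalise-≤ b′ _) d′≤d
prefer beside              (apart d′)  (s≤s ()) _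
prefer beside              beside      _    _ = ≤-refl
prefer beside              between     _    _ = z≤n
prefer between             (apart d′)  (s≤s ()) _
prefer between             beside      _    f = contradiction (f refl) λ { (s≤s ()) }
prefer between             between     _    _ = z≤n

prefer⁻ : ∀ {d b d′ b′} → Status d b → Status d′ b′ → penalise b′ d′ ≤ penalise b d → d′ ≤ d × (d′ ≡ d → b ≤ b′)
prefer⁻ (apart d) (apart d′) p        = p , λ _ → z≤n
prefer⁻ (apart d) beside     p        = s≤s z≤n , λ _ → z≤n
prefer⁻ (apart d) between    p        = s≤s z≤n , λ _ → z≤n
prefer⁻ beside    (apart d′) (s≤s ())
prefer⁻ beside    beside     p        = ≤-refl , λ _ → ≤-refl
prefer⁻ beside    between    p        = ≤-refl , λ _ → s≤s z≤n
prefer⁻ between   between    p        = ≤-refl , λ _ → ≤-refl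

score : Kind → ℕ → ℕ → ℕ
score κ i j = penalise (nbrs κ i j) (dist κ i j)

status : ∀ κ i j → Status (dist κ i j) (nbrs κ i j)
status mid  zero    zero    = between
status mid  zero    (suc j) = beside
status mid  (suc i) zero    = beside
status mid  (suc i) (suc j) = apart (i ⊓ j)
status endL i       zero    = beside
status endL i       (suc j) = apart j
status endR zero    j       = beside
status endR (suc i) j       = apart i

-- Distance 1 is divided into the levels 0 (both neighbours taken) and 1 (one
-- neighbour taken); every other level is a distance.
level : Kind → ℕ → ℕ
level mid  zero    = 0
level mid  (suc m) = radius mid (suc m)
level endL m       = radius endL m
level endR m       = radius endR m

-- The inner gap of one place is the only one where score and level differ from distance and radius;
-- elsewhere the facts about `dist` and `radius` carry over.
data ScoreView : Kind → ℕ → ℕ → Set where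
  single : ScoreView mid 0 0
  plain  : ∀ {κ i j} → score κ i j ≡ dist κ i j → level κ (i + j) ≡ radius κ (i + j) → ScoreView κ i j

scoreView : ∀ κ i j → ScoreView κ i j
scoreView mid  zero    zero    = single
scoreView mid  zero    (suc j) = plain refl refl
scoreView mid  (suc i) zero    = plain refl refl
scoreView mid  (suc i) (suc j) = plain refl refl
scoreView endL i       zero    = plain refl refl
scoreView endL i       (suc j) = plain refl refl
scoreView endR zero    j       = plain refl refl
scoreView endR (suc i) j       = plain refl refl

score≤level : ∀ κ i j → score κ i j ≤ level κ (i + j)
score≤level κ i j with scoreView κ i j
... | single    = z≤n
... | plain p q = subst₂ _≤_ (sym p) (sym q) (dist≤radius κ i j)

central⇒score : ∀ κ i j → Central κ i j → score κ i j ≡ level κ (i + j)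
central⇒score κ i j c with scoreView κ i j
... | single    = refl
... | plain p q = trans p (trans (central⇒dist-maximal κ i j c) (sym q))

score⇒central : ∀ κ i j → level κ (i + j) ≤ score κ i j → Central κ i j
score⇒central κ i j l≤s with scoreView κ i j
... | single    = inj₁ refl
... | plain p q = dist-maximal⇒central κ i j (subst₂ _≤_ q p l≤s)

levelMid levelEnd : ℕ → ℕ → ℕ
levelMid l m = δ (level mid m) l
levelEnd l m = δ (suc m) l

halve-vanish : ∀ v f m → (∀ {m′} → m′ < m → v m′ ≡ 0) → halve v f m ≡ 0
halve-vanish v f       zero    v≡0 = refl
halve-vanish v zero    (suc m) v≡0 = refl
halve-vanish v (suc f) (suc m) v≡0 = cong₂ _+_ (v≡0 ≤-refl) (cong₂ _+_
  (halve-vanish v f ⌊ m /2⌋ λ m′< → v≡0 (m≤n⇒m≤1+n (≤-trans m′< (⌊n/2⌋≤n m))))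
  (halve-vanish v f ⌈ m /2⌉ λ m′< → v≡0 (m≤n⇒m≤1+n (≤-trans m′< (⌈n/2⌉≤n m)))))

level-mid≤ : ∀ m → level mid m ≤ suc m
level-mid≤ zero    = z≤n
level-mid≤ (suc m) = s≤s (⌊n/2⌋≤n (suc m))

-- This strictness is the reason for level 0: an inner gap of two places leaves one of a single
-- place, and both have radius 1.
level-half : ∀ m {m′} → m′ < ⌈ m /2⌉ → level mid m′ < level mid m
level-half (suc m)       {zero}   _         = z<s
level-half (suc (suc m)) {suc m′} (s≤s m′<) = s≤s (⌊n/2⌋-mono (s≤s (≤-trans (s≤s m′<) (⌊n/2⌋<n m))))

-- All proper descendants of the gap have level below `S` and contribute nothing. At the top level,
-- counting the gaps that ever arise is therefore the same as counting those present now.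
value-top : ∀ S κ m → level κ m ≤ S → value (levelMid S) (levelEnd S) κ (suc m) ≡ δ (level κ m) S
value-top S mid m l≤S = trans (midValue-suc (levelMid S) m) (trans (cong (levelMid S m +_) (cong₂ _+_
    (halve-vanish (levelMid S) ⌊ m /2⌋ ⌊ m /2⌋ λ m′< → δ-≢ (<⇒≢ (lower (≤-trans m′< (⌊n/2⌋≤⌈n/2⌉ m)))))
    (halve-vanish (levelMid S) ⌈ m /2⌉ ⌈ m /2⌉ λ m′< → δ-≢ (<⇒≢ (lower m′<)))))
  (+-identityʳ _))
  where
  lower : ∀ {m′} → m′ < ⌈ m /2⌉ → level mid m′ < S
  lower m′< = ≤-trans (level-half m m′<) l≤S
value-top S endL m l≤S = trans (cong (levelEnd S m +_)
  (halve-vanish (levelMid S) m m λ {m′} m′< → δ-≢ (<⇒≢ (≤-trans (s≤s (≤-trans (level-mid≤ m′) m′<)) l≤S)))) (+-identityʳ _)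
value-top S endR m l≤S = value-top S endL m l≤S

levelCount pairCount : List Gap → ℕ → ℕ
levelCount gs l = Φ (levelMid l) (levelEnd l) gs
pairCount  gs l = Φ (pairsMid l) (pairsEnd l) gs

-- Levels below `n` suffice: once somebody is seated a gap has fewer than `n` places, and its level
-- is at most its length.
weight : ℕ → List Gap → ℕ
weight n gs = product (applyUpTo (λ l → 2 ^ pairCount gs l * (levelCount gs l) !) n)

product-cong : ∀ {f g : ℕ → ℕ} N → (∀ l → f l ≡ g l) → product (applyUpTo f N) ≡ product (applyUpTo g N)
product-cong zero    eq = refl
product-cong (suc N) eq = cong₂ _*_ (eq 0) (product-cong N (eq ∘ suc))

product-update : ∀ {f g : ℕ → ℕ} c d N S → S < N → (∀ l → l ≢ S → f l ≡ g l) → c * f S ≡ d * g S →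
                 c * product (applyUpTo f N) ≡ d * product (applyUpTo g N)
product-update {f} {g} c d (suc N) zero _ same eq = begin
  c * (f 0 * product (applyUpTo (f ∘ suc) N)) ≡⟨ *-assoc c (f 0) _ ⟨
  c * f 0 * product (applyUpTo (f ∘ suc) N)   ≡⟨ cong₂ _*_ eq (product-cong N λ l → same (suc l) λ ()) ⟩
  d * g 0 * product (applyUpTo (g ∘ suc) N)   ≡⟨ *-assoc d (g 0) _ ⟩
  d * (g 0 * product (applyUpTo (g ∘ suc) N)) ∎
  where
  open ≡-Reasoning
product-update {f} {g} c d (suc N) (suc S) (s≤s S<N) same eq = begin
  c * (f 0 * product (applyUpTo (f ∘ suc) N)) ≡⟨ swap c (f 0) _ ⟩
  f 0 * (c * product (applyUpTo (f ∘ suc) N)) ≡⟨ cong₂ _*_ (same 0 λ ())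
    (product-update c d N S S<N (λ l l≢S → same (suc l) (l≢S ∘ suc-injective)) eq) ⟩
  g 0 * (d * product (applyUpTo (g ∘ suc) N)) ≡⟨ swap (g 0) d _ ⟩
  d * (g 0 * product (applyUpTo (g ∘ suc) N)) ∎
  where
  open ≡-Reasoning
  swap : ∀ a b c → a * (b * c) ≡ b * (a * c)
  swap = solve-∀

odd-or-even : ∀ m → ⌈ m /2⌉ ≡ ⌊ m /2⌋ ⊎ ⌈ m /2⌉ ≡ suc ⌊ m /2⌋
odd-or-even zero          = inj₁ refl
odd-or-even (suc zero)    = inj₂ refl
odd-or-even (suc (suc m)) with odd-or-even m
... | inj₁ p = inj₁ (cong suc p)
... | inj₂ p = inj₂ (cong suc p)

pair-level : ∀ m l → suc m ≡ l + l → level mid m ≡ l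
pair-level m (suc h) eq with suc-injective eq
... | refl = trans (cong (level mid) (+-suc h h)) (cong suc (trans (sym (cong ⌊_/2⌋ (+-suc h h))) (half-odd h)))

-- Multiplicity of the offset `i` among the two centres. A single middle place counts twice, so
-- every nonempty gap has total multiplicity 2.
centres : Kind → ℕ → ℕ → ℕ
centres κ m i = δ (centre₁ κ m) i + δ (centre₂ κ m) i

gain-other : ∀ κ m l → level κ m ≢ l → gain (pairsMid l) (pairsEnd l) κ m ≡ 0
gain-other mid  m l ≢l = δ-≢ λ eq → ≢l (pair-level m l eq)
gain-other endL m l ≢l = refl
gain-other endR m l ≢l = refl

gain-level : ∀ κ m l → gain (levelMid l) (levelEnd l) κ m ≡ δ (level κ m) l
gain-level mid  m l = refl
gain-level endL m l = refl
gain-level endR m l = refl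

-- An end gap or an odd inner gap has no pair and a double centre, giving 1 * 2; an even inner gap
-- has a pair at its own level and two simple centres, giving 2 * 1.
gain-centres : ∀ κ i j → Central κ i j →
               2 ^ gain (pairsMid (level κ (i + j))) (pairsEnd (level κ (i + j))) κ (i + j) * centres κ (i + j) i ≡ 2
gain-centres mid i j c = go (i + j) refl (odd-or-even (i + j)) c
  where
  go : ∀ m → i + j ≡ m → ⌈ m /2⌉ ≡ ⌊ m /2⌋ ⊎ ⌈ m /2⌉ ≡ suc ⌊ m /2⌋ → i ≡ ⌊ m /2⌋ ⊎ i ≡ ⌈ m /2⌉ →
       2 ^ pairsMid (level mid m) m * centres mid m i ≡ 2
  go m m≡ (inj₁ even) c = cong₂ (λ e s → 2 ^ e * s) (δ-≢ no-pair) (cong₂ _+_ (δ-≡ low) (δ-≡ (trans even low)))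
    where
    low : ⌊ m /2⌋ ≡ i
    low = unify c
      where
      unify : _ → ⌊ m /2⌋ ≡ i
      unify (inj₁ p) = sym p
      unify (inj₂ p) = sym (trans p even)
    no-pair : suc m ≢ level mid m + level mid m
    no-pair eq = 1+n≢n (trans eq (trans (cong₂ _+_ (sym h≡L) (sym h≡L)) (sym m≡h+h)))
      where
      m≡h+h : m ≡ ⌊ m /2⌋ + ⌊ m /2⌋
      m≡h+h = trans (sym (⌊n/2⌋+⌈n/2⌉≡n m)) (cong (⌊ m /2⌋ +_) even)
      h≡L : ⌊ m /2⌋ ≡ level mid m
      h≡L = trans (sym even) (trans (cong ⌊_/2⌋ eq) (sym (n≡⌊n+n/2⌋ (level mid m))))
  go m m≡ (inj₂ odd) c = cong₂ (λ e s → 2 ^ e * s) (δ-≡ pair) (one c)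
    where
    pair : suc m ≡ level mid m + level mid m
    pair = trans suc-m (cong₂ _+_ (sym L≡) (sym L≡))
      where
      suc-m : suc m ≡ suc ⌊ m /2⌋ + suc ⌊ m /2⌋
      suc-m = cong suc (trans (sym (⌊n/2⌋+⌈n/2⌉≡n m)) (cong (⌊ m /2⌋ +_) odd))
      L≡ : level mid m ≡ suc ⌊ m /2⌋
      L≡ = pair-level m (suc ⌊ m /2⌋) suc-m
    one : i ≡ ⌊ m /2⌋ ⊎ i ≡ ⌈ m /2⌉ → centres mid m i ≡ 1
    one (inj₁ p) = cong₂ _+_ (δ-≡ (sym p)) (δ-≢ λ q → 1+n≢n (trans (sym odd) (trans q p)))
    one (inj₂ p) = cong₂ _+_ (δ-≢ λ q → 1+n≢n (trans (sym odd) (sym (trans q p)))) (δ-≡ (sym p))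
gain-centres endL i j (inj₁ refl) = refl
gain-centres endL i j (inj₂ refl) = refl
gain-centres endR i j c with central-endR i j c
... | refl = cong (1 *_) (cong₂ _+_ (δ-≡ (+-identityʳ i)) (δ-≡ (+-identityʳ i)))

applyUpTo-ones : ∀ n → product (applyUpTo (λ _ → 1) n) ≡ 1
applyUpTo-ones zero    = refl
applyUpTo-ones (suc n) = trans (+-identityʳ _) (applyUpTo-ones n)

-- Counting the sequences

placeScore : ∀ {n} → List⁺ (Fin n) → Fin n → ℕ
placeScore occ x = penalise (occupiedNeighbours occ x) (distance occ x)

module _ {n} {occ : List⁺ (Fin n)} {gs} (inv : Gaps n (seats occ) gs) where

  score-in-gap : ∀ {G x} → G ∈ gs → (c : toℕ x ∈cells G) → placeScore occ x ≡ score (kind G) (before c) (after c)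
  score-in-gap {x = x} G∈ (cellAt i j p eq) =
    cong₂ penalise (neighbours-in-gap inv i j x G∈ eq p) (distance-in-gap inv i j x G∈ eq p)

  empty-status : ∀ {x} → Empty occ x → Status (distance occ x) (occupiedNeighbours occ x)
  empty-status {x} x∉ with place inv x∉
  ... | G , G∈ , cellAt i j p eq = subst₂ Status (sym (distance-in-gap inv i j x G∈ eq p))
          (sym (neighbours-in-gap inv i j x G∈ eq p)) (status (kind G) i j)

  extended⇒score : ∀ {x} → ExtendedRule occ x → ∀ y → Empty occ y → placeScore occ y ≤ placeScore occ x
  extended⇒score ((x∉ , best) , polite) y y∉ = prefer (empty-status x∉) (empty-status y∉) (best y y∉)
    -- At equal distance `y` obeys the basic rule as well, so the politeness condition speaks about
    -- it.
    λ d≡ → polite y (y∉ , λ z z∉ → subst (distance occ z ≤_) (sym d≡) (best z z∉))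

  score⇒extended : ∀ {x} → Empty occ x → (∀ y → Empty occ y → placeScore occ y ≤ placeScore occ x) → ExtendedRule occ x
  score⇒extended {x} x∉ best = (x∉ , λ y y∉ → proj₁ (versus y y∉)) ,
    λ y (y∉ , bestʸ) → proj₂ (versus y y∉) (≤-antisym (proj₁ (versus y y∉)) (bestʸ x x∉))
    where
    versus : ∀ y → Empty occ y → distance occ y ≤ distance occ x ×
              (distance occ y ≡ distance occ x → occupiedNeighbours occ x ≤ occupiedNeighbours occ y)
    versus y y∉ = prefer⁻ (empty-status x∉) (empty-status y∉) (best y y∉)

-- Shifted by one to put empty gaps below those of level 0; a gap of maximal rank is then nonempty
-- as soon as any gap is.
rank : Gap → ℕ
rank (gap κ l zero)    = 0
rank (gap κ l (suc m)) = suc (level κ m)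

IsTopLevel : List Gap → ℕ → Set
IsTopLevel gs S = (∀ {G m} → G ∈ gs → len G ≡ suc m → level (kind G) m ≤ S) ×
                  (∃₂ λ G m → G ∈ gs × len G ≡ suc m × level (kind G) m ≡ S)

topLevel : ∀ gs → 1 ≤ total len gs → ∃ (IsTopLevel gs)
topLevel gs pos with total-positive len gs pos
... | G₀ , G₀∈ , len≥1 = finish top top∈ refl (≤-trans (rank-positive G₀ len≥1) (f[⊥]≤f[argmax] {f = rank} G₀ gs))
    λ G∈ → All.lookup (f[xs]≤f[argmax] {f = rank} G₀ gs) G∈
  where
  top : Gap
  top = argmax rank G₀ gs
  top∈ : top ∈ gs
  top∈ with argmax-sel rank G₀ gs
  ... | inj₁ eq = subst (_∈ gs) (sym eq) G₀∈
  ... | inj₂ p  = p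
  rank-positive : ∀ G → 1 ≤ len G → 1 ≤ rank G
  rank-positive (gap κ l (suc m)) _ = z<s
  finish : ∀ T → T ∈ gs → T ≡ top → 1 ≤ rank T → (∀ {G} → G ∈ gs → rank G ≤ rank T) → ∃ (IsTopLevel gs)
  finish (gap κ l (suc m)) T∈ _ _ max = level κ m ,
    (λ { {gap κ′ l′ _} G∈ refl → ≤-pred (max G∈) }) , (gap κ l (suc m) , m , T∈ , refl , refl)

factor-update : ∀ γ ω {D D′ L L′} → 2 ^ γ * ω ≡ 2 → D ≡ γ + D′ → L ≡ suc L′ →
                2 * L * (2 ^ D′ * L′ !) ≡ ω * (2 ^ D * L !)
factor-update γ ω {D′ = D′} {L′ = L′} two refl refl = begin
  2 * suc L′ * (2 ^ D′ * L′ !)             ≡⟨ cong (λ t → t * suc L′ * (2 ^ D′ * L′ !)) two ⟨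
  2 ^ γ * ω * suc L′ * (2 ^ D′ * L′ !)     ≡⟨ rearrange (2 ^ γ) ω (suc L′) (2 ^ D′) (L′ !) ⟩
  ω * (2 ^ γ * 2 ^ D′ * (suc L′ * L′ !))   ≡⟨ cong (λ t → ω * (t * (suc L′ * L′ !))) (^-distribˡ-+-* 2 γ D′) ⟨
  ω * (2 ^ (γ + D′) * (suc L′) !)          ∎
  where
  open ≡-Reasoning
  rearrange : ∀ a b c d e → a * b * c * (d * e) ≡ b * (a * d * (c * e))
  rearrange = solve-∀

atTop : ℕ → Gap → ℕ
atTop S (gap κ l zero)    = 0
atTop S (gap κ l (suc m)) = δ (level κ m) S

levelCount-top : ∀ {gs S} → IsTopLevel gs S → levelCount gs S ≡ total (atTop S) gs
levelCount-top {gs} {S} (max , _) = total-cong-∈ gs λ {G} → pointwise G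
  where
  pointwise : ∀ G → G ∈ gs → value (levelMid S) (levelEnd S) (kind G) (len G) ≡ atTop S G
  pointwise (gap κ l zero)    G∈ = value-zero (levelMid S) (levelEnd S) κ
  pointwise (gap κ l (suc m)) G∈ = value-top S κ m (max G∈ refl)

levelCount-positive : ∀ {gs S} → IsTopLevel gs S → 1 ≤ levelCount gs S
levelCount-positive {gs} {S} t@(_ , gap κ l (suc m) , m , G∈ , refl , level≡) =
  subst (1 ≤_) (sym (levelCount-top {gs} t)) (≤-trans (≤-reflexive (sym (δ-≡ level≡))) (∈⇒≤total (atTop S) G∈))

centresOf : Gap → ℕ → ℕ
centresOf (gap κ l zero)    x = 0
centresOf (gap κ l (suc m)) x = δ (l + centre₁ κ m) x + δ (l + centre₂ κ m) x

module _ {n} {occ : List⁺ (Fin n)} {gs} (inv : Gaps n (seats occ) gs) {S} (top : IsTopLevel gs S) where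

  -- A centre of some top gap has score `S`, so the chosen place scores at least `S`; its score is
  -- at most the level of its own gap, which is at most `S`. Equality throughout gives both claims.
  extended⇒top : ∀ {G x} → G ∈ gs → (c : toℕ x ∈cells G) → ExtendedRule occ x →
                 level (kind G) (before c + after c) ≡ S × Central (kind G) (before c) (after c)
  extended⇒top {G} {x} G∈ c@(cellAt i j p eq) rule =
    ≤-antisym (max eq) (≤-trans S≤ (score≤level (kind G) i j)) , score⇒central (kind G) i j (≤-trans (max eq) S≤)
    where
    max : ∀ {m} → len G ≡ suc m → level (kind G) m ≤ S
    max = proj₁ top G∈
    S≤ : S ≤ score (kind G) i j
    S≤ = let T , m , T∈ , T≡ , level≡ = proj₂ top
             y , a , b , y∉ , q , a+b≡m , central = centre-place inv T∈ T≡
         in subst₂ _≤_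
      (trans (score-in-gap inv {T} {y} T∈ (cellAt a b q (trans T≡ (cong suc (sym a+b≡m)))))
        (trans (central⇒score (kind T) a b central) (trans (cong (level (kind T)) a+b≡m) level≡)))
      (score-in-gap inv {G} {x} G∈ c) (extended⇒score inv rule y y∉)

  top⇒extended : ∀ {G x} → G ∈ gs → (c : toℕ x ∈cells G) → level (kind G) (before c + after c) ≡ S →
                 Central (kind G) (before c) (after c) → ExtendedRule occ x
  top⇒extended {G} {x} G∈ c@(cellAt i j p eq) level≡ central =
    score⇒extended inv (cell-empty inv i j G∈ eq p) λ y y∉ → subst (placeScore occ y ≤_)
      (sym (trans (score-in-gap inv {G} {x} G∈ c) (trans (central⇒score (kind G) i j central) level≡))) (bound y y∉)
    where
    bound : ∀ y → Empty occ y → placeScore occ y ≤ S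
    bound y y∉ with place inv y∉
    ... | H , H∈ , d@(cellAt a b q eq′) = subst (_≤ S) (sym (score-in-gap inv {H} {y} H∈ d))
          (≤-trans (score≤level (kind H) a b) (proj₁ top H∈ eq′))

  centre-sum : ∀ {κ l m a} → gap κ l (suc m) ∈ gs → a ≤ m → a ≡ centre₁ κ m ⊎ a ≡ centre₂ κ m →
               total (λ x → ind (extendedRule? occ x) * δ (l + a) (toℕ x)) (allFin n) ≡ δ (level κ m) S
  centre-sum {κ} {l} {m} {a} G∈ a≤m is-centre = begin
    total (λ x → ind (extendedRule? occ x) * δ (l + a) (toℕ x)) (allFin n)
      ≡⟨ total-cong pointwise (allFin n) ⟩
    total (λ x → δ (level κ m) S * δ (l + a) (toℕ x)) (allFin n)
      ≡⟨ total-* (δ (level κ m) S) _ (allFin n) ⟩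
    δ (level κ m) S * total (λ x → δ (l + a) (toℕ x)) (allFin n)
      ≡⟨ cong (δ (level κ m) S *_) (total-δ (proj₁ (cell inv a (m ∸ a) G∈ (cong suc (sym a+b))))) ⟩
    δ (level κ m) S * 1
      ≡⟨ *-identityʳ _ ⟩
    δ (level κ m) S ∎
    where
    open ≡-Reasoning
    a+b : a + (m ∸ a) ≡ m
    a+b = m+[n∸m]≡n a≤m
    central : Central κ a (m ∸ a)
    central = subst (λ m → a ≡ centre₁ κ m ⊎ a ≡ centre₂ κ m) (sym a+b) is-centre
    pointwise : ∀ x → ind (extendedRule? occ x) * δ (l + a) (toℕ x) ≡ δ (level κ m) S * δ (l + a) (toℕ x)
    pointwise x with l + a ≟ toℕ x
    ... | yes p = cong (_* δ (l + a) (toℕ x)) (ind-⇔ (extendedRule? occ x) (level κ m ≟ S)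
            (λ rule → trans (cong (level κ) (sym a+b)) (proj₁ (extended⇒top G∈ c rule)))
            (λ level≡ → top⇒extended G∈ c (trans (cong (level κ) a+b) level≡) central))
      where
      c : toℕ x ∈cells gap κ l (suc m)
      c = cellAt a (m ∸ a) (sym p) (cong suc (sym a+b))
    ... | no ¬p rewrite δ-≢ ¬p = trans (*-zeroʳ (ind (extendedRule? occ x))) (sym (*-zeroʳ (δ (level κ m) S)))

  centresOf-sum : ∀ {G} → G ∈ gs → total (λ x → ind (extendedRule? occ x) * centresOf G (toℕ x)) (allFin n) ≡ 2 * atTop S G
  centresOf-sum {gap κ l zero} G∈ = total-zero (allFin n) λ {x} _ → *-zeroʳ (ind (extendedRule? occ x))
  centresOf-sum {gap κ l (suc m)} G∈ = begin
    total (λ x → ind (extendedRule? occ x) * (δ (l + centre₁ κ m) (toℕ x) + δ (l + centre₂ κ m) (toℕ x))) (allFin n)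
      ≡⟨ total-cong (λ x → *-distribˡ-+ (ind (extendedRule? occ x)) (δ (l + centre₁ κ m) (toℕ x)) _) (allFin n) ⟩
    total (λ x → ind (extendedRule? occ x) * δ (l + centre₁ κ m) (toℕ x) +
                 ind (extendedRule? occ x) * δ (l + centre₂ κ m) (toℕ x)) (allFin n)
      ≡⟨ total-+ _ _ (allFin n) ⟩
    _ ≡⟨ cong₂ _+_ (centre-sum G∈ (centre₁≤ κ m) (inj₁ refl)) (centre-sum G∈ (centre₂≤ κ m) (inj₂ refl)) ⟩
    δ (level κ m) S + δ (level κ m) S
      ≡⟨ cong (δ (level κ m) S +_) (+-identityʳ _) ⟨
    2 * δ (level κ m) S ∎
    where
    open ≡-Reasoning

  centresOf-all : ∀ {G x} (G∈ : G ∈ gs) (c : x ∈cells G) →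
                  total (λ H → centresOf H x) gs ≡ centres (kind G) (before c + after c) (before c)
  centresOf-all {gap κ l _} {x} G∈ c@(cellAt i j refl refl) = begin
    total (λ H → centresOf H x) gs
      ≡⟨ total-─ (λ H → centresOf H x) G∈ ⟩
    δ (l + centre₁ κ (i + j)) (l + i) + δ (l + centre₂ κ (i + j)) (l + i) + total (λ H → centresOf H x) (gs ─ G∈)
      ≡⟨ cong₂ _+_ (cong₂ _+_ (δ-shift l) (δ-shift l)) (total-zero (gs ─ G∈) λ {H} H∈ → others H (elsewhere inv G∈ c H∈)) ⟩
    centres κ (i + j) i + 0
      ≡⟨ +-identityʳ _ ⟩
    centres κ (i + j) i ∎
    where
    open ≡-Reasoning
    δ-shift : ∀ l {a b} → δ (l + a) (l + b) ≡ δ a b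
    δ-shift zero    = refl
    δ-shift (suc l) = δ-shift l
    others : ∀ H → ¬ x ∈cells H → centresOf H x ≡ 0
    others (gap κ l zero)    x∉ = refl
    others (gap κ l (suc m)) x∉ = cong₂ _+_ (δ-≢ (not-at (centre₁≤ κ m))) (δ-≢ (not-at (centre₂≤ κ m)))
      where
      not-at : ∀ {a} → a ≤ m → l + a ≢ x
      not-at {a} a≤m p = x∉ (cellAt a (m ∸ a) (sym p) (cong suc (sym (m+[n∸m]≡n a≤m))))

  -- Double counting of the incidences between permitted places and centres of gaps: a gap of level
  -- `S` contributes both its centres, any other gap none.
  extended-centres : total (λ x → ind (extendedRule? occ x) * total (λ G → centresOf G (toℕ x)) gs) (allFin n) ≡
                     2 * levelCount gs S
  extended-centres = begin
    total (λ x → rule x * total (λ G → centresOf G (toℕ x)) gs) (allFin n)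
      ≡⟨ total-cong (λ x → sym (total-* (rule x) (λ G → centresOf G (toℕ x)) gs)) (allFin n) ⟩
    total (λ x → total (λ G → rule x * centresOf G (toℕ x)) gs) (allFin n)
      ≡⟨ total-swap (λ x G → rule x * centresOf G (toℕ x)) (allFin n) gs ⟩
    total (λ G → total (λ x → rule x * centresOf G (toℕ x)) (allFin n)) gs
      ≡⟨ total-cong-∈ gs centresOf-sum ⟩
    total (λ G → 2 * atTop S G) gs
      ≡⟨ total-* 2 (atTop S) gs ⟩
    2 * total (atTop S) gs
      ≡⟨ cong (2 *_) (levelCount-top {gs} top) ⟨
    2 * levelCount gs S ∎
    where
    open ≡-Reasoning
    rule : Fin n → ℕ
    rule x = ind (extendedRule? occ x)

  -- Taking a central place of a gap of the top level S removes one of the levelCount gs S factors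
  -- of the factorial, and one factor 2 exactly when that gap has two central places.
  weight-split : ∀ {G} (G∈ : G ∈ gs) {x} (c : x ∈cells G) → level (kind G) (before c + after c) ≡ S →
                 Central (kind G) (before c) (after c) →
                 2 * levelCount gs S * weight n (split gs G∈ (before c) (after c)) ≡
                 centres (kind G) (before c + after c) (before c) * weight n gs
  weight-split {G} G∈ (cellAt i j p eq) level≡ central =
    product-update {λ l → 2 ^ pairCount gs′ l * (levelCount gs′ l) !} {λ l → 2 ^ pairCount gs l * (levelCount gs l) !}
      (2 * levelCount gs S) (centres κ m i) n S S<n same at-S
    where
    κ = kind G
    m = i + j
    gs′ = split gs G∈ i j
    S<n : S < n
    S<n = subst (_< n) level≡ (≤-trans (s≤s (level≤ κ)) (len<n G (All.lookup (Gaps.bounded inv) G∈) eq))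
      where
      level≤ : ∀ κ → level κ m ≤ suc m
      level≤ mid  = level-mid≤ m
      level≤ endL = ≤-refl
      level≤ endR = ≤-refl
      len<n : ∀ G → Bounded n (seats occ) G → len G ≡ suc m → suc m < n
      len<n (gap mid l h)        (_ , b) refl = ≤-trans (s≤s (m≤n+m h l)) (∈os⇒<n inv b)
      len<n (gap endL l h)       (_ , b) refl = ≤-trans (s≤s (m≤n+m h l)) (∈os⇒<n inv b)
      len<n (gap endR (suc l) h) (_ , b) refl = subst (h <_) b (s≤s (m≤n+m h l))
    pairs : ∀ l → pairCount gs l ≡ gain (pairsMid l) (pairsEnd l) κ m + pairCount gs′ l
    pairs l = Φ-split inv i j G∈ eq central (pairsMid l) (pairsEnd l)
    levels : ∀ l → levelCount gs l ≡ δ (level κ m) l + levelCount gs′ l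
    levels l = trans (Φ-split inv i j G∈ eq central (levelMid l) (levelEnd l)) (cong (_+ levelCount gs′ l) (gain-level κ m l))
    same : ∀ l → l ≢ S → 2 ^ pairCount gs′ l * (levelCount gs′ l) ! ≡ 2 ^ pairCount gs l * (levelCount gs l) !
    same l l≢S = cong₂ (λ d b → 2 ^ d * b !)
      (sym (trans (pairs l) (cong (_+ pairCount gs′ l) (gain-other κ m l λ q → l≢S (trans (sym q) level≡)))))
      (sym (trans (levels l) (cong (_+ levelCount gs′ l) (δ-≢ λ q → l≢S (trans (sym q) level≡)))))
    at-S : 2 * levelCount gs S * (2 ^ pairCount gs′ S * (levelCount gs′ S) !) ≡
           centres κ m i * (2 ^ pairCount gs S * (levelCount gs S) !)
    at-S = factor-update (gain (pairsMid S) (pairsEnd S) κ m) (centres κ m i)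
      (subst (λ S → 2 ^ gain (pairsMid S) (pairsEnd S) κ m * centres κ m i ≡ 2) level≡ (gain-centres κ i j central))
      (pairs S) (trans (levels S) (cong (_+ levelCount gs′ S) (δ-≡ level≡)))

obeysAfter? : ∀ {n} (occ : List⁺ (Fin n)) xs → Dec (All (uncurry ExtendedRule) (arrivalsAfter occ xs))
obeysAfter? occ xs = All.all? (uncurry extendedRule?) (arrivalsAfter occ xs)

ways : ∀ {n} → List⁺ (Fin n) → ℕ → ℕ
ways {n} occ r = total (λ xs → ind (obeysAfter? occ (toList xs))) (words n r)

ways-suc : ∀ {n} (occ : List⁺ (Fin n)) r →
           ways occ (suc r) ≡ total (λ x → ind (extendedRule? occ x) * ways (x ∷⁺ occ) r) (allFin n)
ways-suc {n} occ r = trans (total-product (λ (xs : Vec (Fin n) (suc r)) → ind (obeysAfter? occ (toList xs))) Vec._∷_ (allFin n) (words n r))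
  (total-cong (λ x → trans
    (total-cong (λ xs → ind-× (extendedRule? occ x) (obeysAfter? (x ∷⁺ occ) (toList xs))) (words n r))
    (total-* (ind (extendedRule? occ x)) _ (words n r))) (allFin n))

-- A division-free averaging argument: every permitted `x` has the share `g x / c` of `N`, and the
-- shares add up to 1. Positivity of `c` allows cancelling it.
total-proportional : ∀ {X : Set} (xs : List X) {P : X → Set} (P? : ∀ x → Dec (P x)) (f g : X → ℕ) c N → 1 ≤ c →
                     (∀ x → P x → c * f x ≡ g x * N) → total (λ x → ind (P? x) * g x) xs ≡ c →
                     total (λ x → ind (P? x) * f x) xs ≡ N
total-proportional xs P? f g c N pos eq sum≡ = *-cancelˡ-≡ _ _ c {{>-nonZero pos}} (begin
  c * total (λ x → ind (P? x) * f x) xs   ≡⟨ total-* c _ xs ⟨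
  total (λ x → c * (ind (P? x) * f x)) xs ≡⟨ total-cong (λ x → by-dec (P? x) (eq x)) xs ⟩
  total (λ x → N * (ind (P? x) * g x)) xs ≡⟨ total-* N _ xs ⟩
  N * total (λ x → ind (P? x) * g x) xs   ≡⟨ cong (N *_) sum≡ ⟩
  N * c                                   ≡⟨ *-comm N c ⟩
  c * N                                   ∎)
  where
  open ≡-Reasoning
  by-dec : ∀ {P : Set} {a b} (d : Dec P) → (P → c * a ≡ b * N) → c * (ind d * a) ≡ N * (ind d * b)
  by-dec             (no _)  _ = trans (*-zeroʳ c) (sym (*-zeroʳ N))
  by-dec {a = a} {b} (yes p) e = trans (cong (c *_) (*-identityˡ a))
    (trans (e p) (trans (*-comm b N) (cong (N *_) (sym (*-identityˡ b)))))

weight-full : ∀ n {gs} → total len gs ≡ 0 → weight n gs ≡ 1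
weight-full n {gs} size = trans
  (product-cong {λ l → 2 ^ pairCount gs l * (levelCount gs l) !} {λ l → 1} n λ l → cong₂ (λ d b → 2 ^ d * b !)
    {pairCount gs l} {0} {levelCount gs l} {0}
    (total-len-zero (pairsMid l) (pairsEnd l) gs size) (total-len-zero (levelMid l) (levelEnd l) gs size))
  (applyUpTo-ones n)

ways-step : ∀ {n} r (occ : List⁺ (Fin n)) {gs S} (inv : Gaps n (seats occ) gs) → total len gs ≡ suc r → IsTopLevel gs S →
            (∀ x {gs′} → Gaps n (seats (x ∷⁺ occ)) gs′ → total len gs′ ≡ r → ways (x ∷⁺ occ) r ≡ weight n gs′) →
            ∀ x → ExtendedRule occ x →
            2 * levelCount gs S * ways (x ∷⁺ occ) r ≡ total (λ G → centresOf G (toℕ x)) gs * weight n gs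
ways-step {n} r occ {gs} {S} inv size top ih x ok = at (place inv (proj₁ (proj₁ ok)))
  where
  at : (∃ λ G → G ∈ gs × toℕ x ∈cells G) →
       2 * levelCount gs S * ways (x ∷⁺ occ) r ≡ total (λ G → centresOf G (toℕ x)) gs * weight n gs
  at (G , G∈ , c@(cellAt i j p eq)) = trans
    (cong (2 * levelCount gs S *_)
      (ih x (after-seat inv G∈ c) (suc-injective (trans (sym (size-split inv i j G∈ eq)) size))))
    (trans (weight-split inv top G∈ c (proj₁ top-central) (proj₂ top-central))
      (cong (_* weight n gs) (sym (centresOf-all inv top G∈ c))))
    where
    top-central : level (kind G) (i + j) ≡ S × Central (kind G) i j
    top-central = extended⇒top inv top G∈ c ok

-- By induction each permitted place accounts for a share of the weight proportional to its
-- multiplicity as a centre, and by `extended-centres` these shares exhaust the weight.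
ways-weight : ∀ {n} r (occ : List⁺ (Fin n)) {gs} → Gaps n (seats occ) gs → total len gs ≡ r → ways occ r ≡ weight n gs
ways-weight {n} zero    occ {gs} inv size = sym (weight-full n {gs} size)
ways-weight {n} (suc r) occ {gs} inv size with topLevel gs (subst (1 ≤_) (sym size) z<s)
... | S , top = trans (ways-suc occ r)
  (total-proportional (allFin n) (extendedRule? occ) (λ x → ways (x ∷⁺ occ) r)
    (λ x → total (λ G → centresOf G (toℕ x)) gs) (2 * levelCount gs S) (weight n gs)
    (≤-trans (levelCount-positive {gs} top) (m≤m+n (levelCount gs S) _))
    (ways-step r occ inv size top (λ x → ways-weight r (x ∷⁺ occ))) (extended-centres inv top))

-- The first person and the formula

ends : ℕ → ℕ → List Gap
ends i j = gap endL 0 i ∷ gap endR (suc i) j ∷ []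

ends-gaps : ∀ i j → Gaps (i + suc j) (i ∷ []) (ends i j)
ends-gaps i j = record
  { bounded = (refl , here refl) ∷ (here refl , sym (+-suc i j)) ∷ []
  ; tiling  = λ x → trans (rearrange (χ 0 i x) (χ (suc i) j x) (δ i x)) (sym (χ-split 0 i j x))
  }
  where
  rearrange : ∀ a b c → a + (b + 0) + (c + 0) ≡ a + (c + b)
  rearrange = solve-∀

ends-size : ∀ i j → total len (ends i j) ≡ i + j
ends-size i j = cong (i +_) (+-identityʳ j)

A-weight : ∀ m → A (suc m) ≡ sum (applyUpTo (λ i → weight (suc m) (ends i (m ∸ i))) (suc m))
A-weight m = begin
  A (suc m)
    ≡⟨ length-filter-total (λ xs → obeysExtended? (toList xs)) (words (suc m) (suc m)) ⟩
  total (λ xs → ind (obeysExtended? (toList xs))) (words (suc m) (suc m))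
    ≡⟨ total-product (λ xs → ind (obeysExtended? (toList xs))) Vec._∷_ (allFin (suc m)) (words (suc m) m) ⟩
  total (λ x → ways (x ∷ []) m) (allFin (suc m))
    ≡⟨ total-cong start (allFin (suc m)) ⟩
  total (λ x → weight (suc m) (ends (toℕ x) (m ∸ toℕ x))) (allFin (suc m))
    ≡⟨ total-allFin (suc m) (λ i → weight (suc m) (ends i (m ∸ i))) ⟩
  sum (applyUpTo (λ i → weight (suc m) (ends i (m ∸ i))) (suc m)) ∎
  where
  open ≡-Reasoning
  start : ∀ x → ways (x ∷ []) m ≡ weight (suc m) (ends (toℕ x) (m ∸ toℕ x))
  start x = ways-weight m (x ∷ [])
    (subst (λ n → Gaps n (toℕ x ∷ []) (ends (toℕ x) (m ∸ toℕ x)))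
      (trans (+-suc (toℕ x) _) (cong suc (m+[n∸m]≡n x≤m))) (ends-gaps (toℕ x) (m ∸ toℕ x)))
    (trans (ends-size (toℕ x) (m ∸ toℕ x)) (m+[n∸m]≡n x≤m))
    where
    x≤m : toℕ x ≤ m
    x≤m = ≤-pred (toℕ<n x)

endPersons endPairs endLevels : ℕ → ℕ → ℕ
endPersons k = endValue (personsMid k) (personsEnd k)
endPairs   k = endValue (pairsMid k) (pairsEnd k)
endLevels  l = endValue (levelMid l) (levelEnd l)

module _ {q} (F : LeftFilling (suc q)) where
  open LeftFilling F

  private
    leftmost : ∀ (xs : Vec (Fin (suc q)) (suc q)) → LeftmostFirst (toList xs) →
               Gaps (suc q) (seats (Vec.head xs ∷ [])) (ends 0 q)
    leftmost (x Vec.∷ xs) x≡0 = subst (λ y → Gaps (suc q) (y ∷ []) (ends 0 q)) (sym x≡0) (ends-gaps 0 q)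

    rest-size : ∀ (xs : Vec (Fin (suc q)) (suc q)) → total len (ends 0 q) ≡ length (toList (Vec.tail xs))
    rest-size (x Vec.∷ xs) = trans (ends-size 0 q) (sym (length-toList xs))

  -- A first person on the leftmost of `suc q` places leaves an empty left gap and a right end gap
  -- of `q` places; hence the shift by one between the first index of b and d and the length of an
  -- end gap.
  personsAtDistance-end : ∀ k → personsAtDistance F k ≡ endPersons k q
  personsAtDistance-end k with places | leftmostFirst | basic
  ... | x Vec.∷ xs | x≡0 | rules = trans (length-filter-total (λ (o , y) → distance o y ≟ k) (arrivalsAfter (x ∷ []) (toList xs)))
    (trans (personsAt-Φ k (x ∷ []) (toList xs) (leftmost (x Vec.∷ xs) x≡0) (rest-size (x Vec.∷ xs)) rules)
      (+-identityʳ _))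

  pairsAtDistance-end : ∀ k → pairsAtDistance F k ≡ endPairs k q
  pairsAtDistance-end k = trans (length-filter-total (isPairAtDistance? F k) (allPairs (suc q))) (go places leftmostFirst basic)
    where
    go : ∀ (xs : Vec (Fin (suc q)) (suc q)) → LeftmostFirst (toList xs) → Obeys BasicRule (toList xs) →
         total (λ xy → ind (pairIn? k (arrivals (toList xs)) xy)) (allPairs (suc q)) ≡ endPairs k q
    go xs@(x Vec.∷ ys) x≡0 rules = trans (pairIn-Φ k (x ∷ []) (toList ys) (leftmost xs x≡0) (rest-size xs) rules)
      (+-identityʳ _)

-- Levels of gaps in terms of b and d

halve-cong : ∀ {v v′} → (∀ m → v m ≡ v′ m) → ∀ f m → halve v f m ≡ halve v′ f m
halve-cong eq f       zero    = refl
halve-cong eq zero    (suc m) = refl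
halve-cong eq (suc f) (suc m) = cong₂ _+_ (eq m) (cong₂ _+_ (halve-cong eq f ⌊ m /2⌋) (halve-cong eq f ⌈ m /2⌉))

halve-+ : ∀ v v′ f m → halve (λ m → v m + v′ m) f m ≡ halve v f m + halve v′ f m
halve-+ v v′ f       zero    = refl
halve-+ v v′ zero    (suc m) = refl
halve-+ v v′ (suc f) (suc m) rewrite halve-+ v v′ f ⌊ m /2⌋ | halve-+ v v′ f ⌈ m /2⌉ =
  rearrange (v m) (v′ m) (halve v f ⌊ m /2⌋) (halve v′ f ⌊ m /2⌋) (halve v f ⌈ m /2⌉) (halve v′ f ⌈ m /2⌉)
  where
  rearrange : ∀ a a′ b b′ c c′ → a + a′ + (b + b′ + (c + c′)) ≡ a + (b + c) + (a′ + (b′ + c′))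
  rearrange = solve-∀

-- Hence level 0 contributes a factorial but no power of 2.
pairs-zero : ∀ q → endPairs 0 q ≡ 0
pairs-zero zero    = refl
pairs-zero (suc m) = halve-vanish (pairsMid 0) m m λ _ → refl

levels-persons : ∀ l q → endLevels (2 + l) q ≡ endPersons (2 + l) q
levels-persons l zero    = refl
levels-persons l (suc m) = cong (levelEnd (2 + l) m +_) (halve-cong pointwise m m)
  where
  pointwise : ∀ m → levelMid (2 + l) m ≡ personsMid (2 + l) m
  pointwise zero    = refl
  pointwise (suc m) = refl

-- For an inner gap, level 1 means two places, which is also what makes a pair at distance 1.
mid-level-one : ∀ m → midValue (levelMid 1) m ≡ midValue (pairsMid 1) m
mid-level-one m = halve-cong pointwise m m
  where
  pointwise : ∀ m → levelMid 1 m ≡ pairsMid 1 m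
  pointwise zero          = refl
  pointwise (suc zero)    = refl
  pointwise (suc (suc m)) = refl

-- From two places on, an end gap is entered at distance at least 2, so it is not itself of level 1.
-- An end gap of one place is of level 1 but has no pair.
levels-one : ∀ q → endLevels 1 (2 + q) ≡ endPairs 1 (2 + q)
levels-one q = mid-level-one (suc q)

persons-one : ∀ q → endPersons 1 q ≡ endLevels 0 q + endLevels 1 q
persons-one zero    = refl
persons-one (suc m) = trans
  (cong (personsEnd 1 m +_) (trans (halve-cong pointwise m m) (halve-+ (levelMid 0) (levelMid 1) m m)))
  (rearrange (personsEnd 1 m) (midValue (levelMid 0) m) (midValue (levelMid 1) m))
  where
  rearrange : ∀ a b c → a + (b + c) ≡ b + (a + c)
  rearrange = solve-∀
  pointwise : ∀ m → personsMid 1 m ≡ levelMid 0 m + levelMid 1 m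
  pointwise zero          = refl
  pointwise (suc zero)    = refl
  pointwise (suc (suc m)) = refl

-- Read as a difference: b minus d at distance 1 is the number of inner gaps of one place that ever
-- arise.
persons∸pairs : ∀ q → endPersons 1 (2 + q) ≡ endLevels 0 (2 + q) + endPairs 1 (2 + q)
persons∸pairs q = trans (persons-one (2 + q)) (cong (endLevels 0 (2 + q) +_) (levels-one q))

summand : ℕ → ℕ → ℕ → ℕ → ℕ
summand d e s p = 2 ^ d * e ! * s ! * p

summand-cong : ∀ {d d′ e e′ s s′ p p′} → d ≡ d′ → e ≡ e′ → s ≡ s′ → p ≡ p′ → summand d e s p ≡ summand d′ e′ s′ p′
summand-cong refl refl refl refl = refl

double-summand : ∀ d e s p → 2 * summand d e s p ≡ 2 * 2 ^ d * e ! * s ! * p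
double-summand d e s p = rearrange (2 ^ d) (e !) (s !) p
  where
  rearrange : ∀ a b c p → 2 * (a * b * c * p) ≡ 2 * a * b * c * p
  rearrange = solve-∀

weight-ends : ∀ N i j → weight (2 + N) (ends i j) ≡
  summand (endPairs 1 i + endPairs 1 j) (endLevels 1 i + endLevels 1 j) (endLevels 0 i + endLevels 0 j)
    (product (applyUpTo (λ l → 2 ^ (endPairs (2 + l) i + endPairs (2 + l) j) *
                               (endPersons (2 + l) i + endPersons (2 + l) j) !) N))
weight-ends N i j = trans
  (product-cong (2 + N) λ l → cong₂ (λ d b → 2 ^ d * b !)
    (cong (endPairs l i +_) (+-identityʳ (endPairs l j))) (cong (endLevels l i +_) (+-identityʳ (endLevels l j))))
  (arithmetic {d = endPairs 1 i + endPairs 1 j} {endLevels 1 i + endLevels 1 j} {endLevels 0 i + endLevels 0 j}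
    (cong₂ _+_ (pairs-zero i) (pairs-zero j)) (product-cong N λ l →
    cong₂ (λ a b → 2 ^ (endPairs (2 + l) i + endPairs (2 + l) j) * (a + b) !) (levels-persons l i) (levels-persons l j)))
  where
  arithmetic : ∀ {d e s d₀ p p′} → d₀ ≡ 0 → p ≡ p′ → 2 ^ d₀ * s ! * (2 ^ d * e ! * p) ≡ summand d e s p′
  arithmetic {d} {e} {s} {p = p} refl refl = rearrange (s !) (2 ^ d) (e !) p
    where
    rearrange : ∀ s d e p → 1 * s * (d * e * p) ≡ d * e * s * p
    rearrange = solve-∀

weight-swap : ∀ n i j → weight n (ends i j) ≡ weight n (ends j i)
weight-swap n i j = product-cong n λ l → cong₂ (λ d b → 2 ^ d * b !)
  (swap (endPairs l i) (endPairs l j)) (swap (endLevels l i) (endLevels l j))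
  where
  swap : ∀ a b → a + (b + 0) ≡ b + (a + 0)
  swap = solve-∀

sum-cong-< : ∀ {f g : ℕ → ℕ} N → (∀ {i} → i < N → f i ≡ g i) → sum (applyUpTo f N) ≡ sum (applyUpTo g N)
sum-cong-< zero    eq = refl
sum-cong-< (suc N) eq = cong₂ _+_ (eq z<s) (sum-cong-< N λ i<N → eq (s<s i<N))

sum-last : ∀ (f : ℕ → ℕ) N → sum (applyUpTo f (suc N)) ≡ sum (applyUpTo f N) + f N
sum-last f N = trans (cong sum (sym (applyUpTo-∷ʳ f N)))
  (trans (sum-++ (applyUpTo f N) (f N ∷ [])) (cong (sum (applyUpTo f N) +_) (+-identityʳ (f N))))

-- Mirror symmetry identifies the two outermost positions of the first person, and likewise the next
-- two. With `4 + N` positions these four are distinct; what remains is the sum over i in the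
-- formula.
sum-symmetric-ends : ∀ (f : ℕ → ℕ) N → f 0 ≡ f (3 + N) → f 1 ≡ f (2 + N) →
  sum (applyUpTo f (4 + N)) ≡ 2 * f 0 + 2 * f 1 + sum (applyUpTo (λ i → f (2 + i)) N)
sum-symmetric-ends f N outer inner = begin
  f 0 + (f 1 + sum (applyUpTo g (2 + N)))
    ≡⟨ cong (λ s → f 0 + (f 1 + s)) (trans (sum-last g (suc N)) (cong (_+ g (suc N)) (sum-last g N))) ⟩
  f 0 + (f 1 + (sum (applyUpTo g N) + f (2 + N) + f (3 + N)))
    ≡⟨ cong₂ (λ a b → f 0 + (f 1 + (sum (applyUpTo g N) + a + b))) (sym inner) (sym outer) ⟩
  f 0 + (f 1 + (sum (applyUpTo g N) + f 1 + f 0))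
    ≡⟨ rearrange (f 0) (f 1) (sum (applyUpTo g N)) ⟩
  2 * f 0 + 2 * f 1 + sum (applyUpTo g N) ∎
  where
  open ≡-Reasoning
  g : ℕ → ℕ
  g i = f (2 + i)
  rearrange : ∀ a b s → a + (b + (s + b + a)) ≡ 2 * a + 2 * b + s
  rearrange = solve-∀

module _ {b d : ℕ → ℕ → ℕ}
         (b-end : ∀ q k → b (suc q) k ≡ endPersons k q) (d-end : ∀ q k → d (suc q) k ≡ endPairs k q) where

  levels-zero : ∀ q → endLevels 0 (2 + q) ≡ b (3 + q) 1 ∸ d (3 + q) 1
  levels-zero q = sym (trans (cong₂ _∸_ (trans (b-end (2 + q) 1) (persons∸pairs q)) (d-end (2 + q) 1))
                             (m+n∸n≡m (endLevels 0 (2 + q)) (endPairs 1 (2 + q))))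

  weight-first : ∀ N q → weight (2 + N) (ends 0 (2 + q)) ≡
    summand (d (3 + q) 1) (d (3 + q) 1) (b (3 + q) 1 ∸ d (3 + q) 1)
      (product (applyUpTo (λ l → 2 ^ d (3 + q) (2 + l) * (b (3 + q) (2 + l)) !) N))
  weight-first N q = trans (weight-ends N 0 (2 + q)) (summand-cong
    (sym (d-end (2 + q) 1)) (trans (levels-one q) (sym (d-end (2 + q) 1))) (levels-zero q)
    (product-cong N λ l → cong₂ (λ d b → 2 ^ d * b !) (sym (d-end (2 + q) (2 + l))) (sym (b-end (2 + q) (2 + l)))))

  weight-second : ∀ N q → weight (2 + N) (ends 1 (2 + q)) ≡
    summand (d (3 + q) 1) (d (3 + q) 1 + 1) (b (3 + q) 1 ∸ d (3 + q) 1)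
      (product (applyUpTo (λ l → 2 ^ d (3 + q) (2 + l) * (b (3 + q) (2 + l)) !) N))
  weight-second N q = trans (weight-ends N 1 (2 + q)) (summand-cong
    -- The `suc` is the left end gap of one place, which has level 1 and adds nothing to any other
    -- factor.
    (sym (d-end (2 + q) 1)) (trans (cong suc (trans (levels-one q) (sym (d-end (2 + q) 1)))) (+-comm 1 _)) (levels-zero q)
    (product-cong N λ l → cong₂ (λ d b → 2 ^ d * b !) (sym (d-end (2 + q) (2 + l))) (sym (b-end (2 + q) (2 + l)))))

  -- Both end gaps have at least two places, so `levels-one` applies to each and no correction
  -- appears.
  weight-inner : ∀ N q r → weight (2 + N) (ends (2 + q) (2 + r)) ≡
    summand (d (3 + q) 1 + d (3 + r) 1) (d (3 + q) 1 + d (3 + r) 1)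
      (b (3 + q) 1 + b (3 + r) 1 ∸ d (3 + q) 1 ∸ d (3 + r) 1)
      (product (applyUpTo (λ l → 2 ^ (d (3 + q) (2 + l) + d (3 + r) (2 + l)) * (b (3 + q) (2 + l) + b (3 + r) (2 + l)) !) N))
  weight-inner N q r = trans (weight-ends N (2 + q) (2 + r)) (summand-cong
    (sym pairs) (trans (cong₂ _+_ (levels-one q) (levels-one r)) (sym pairs)) (sym singles)
    (product-cong N λ l → cong₂ (λ d b → 2 ^ d * b !)
      (sym (cong₂ _+_ (d-end (2 + q) (2 + l)) (d-end (2 + r) (2 + l))))
      (sym (cong₂ _+_ (b-end (2 + q) (2 + l)) (b-end (2 + r) (2 + l))))))
    where
    pairs : d (3 + q) 1 + d (3 + r) 1 ≡ endPairs 1 (2 + q) + endPairs 1 (2 + r)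
    pairs = cong₂ _+_ (d-end (2 + q) 1) (d-end (2 + r) 1)
    cancel : ∀ s t x y {u v} → u ≡ s + x → v ≡ t + y → u + v ∸ x ∸ y ≡ s + t
    cancel s t x y refl refl = trans (∸-+-assoc (s + x + (t + y)) x y)
      (trans (cong (_∸ (x + y)) (rearrange s t x y)) (m+n∸n≡m (s + t) (x + y)))
      where
      rearrange : ∀ s t x y → s + x + (t + y) ≡ s + t + (x + y)
      rearrange = solve-∀
    singles : b (3 + q) 1 + b (3 + r) 1 ∸ d (3 + q) 1 ∸ d (3 + r) 1 ≡ endLevels 0 (2 + q) + endLevels 0 (2 + r)
    singles = cancel _ _ (d (3 + q) 1) (d (3 + r) 1)
      (trans (b-end (2 + q) 1) (trans (persons∸pairs q) (cong (endLevels 0 (2 + q) +_) (sym (d-end (2 + q) 1)))))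
      (trans (b-end (2 + r) 1) (trans (persons∸pairs r) (cong (endLevels 0 (2 + r) +_) (sym (d-end (2 + r) 1)))))

mainTheorem8 :
    (F : ∀ p → LeftFilling p) →
    let b : ℕ → ℕ → ℕ
        b p k = personsAtDistance (F p) k
        d : ℕ → ℕ → ℕ
        d p k = pairsAtDistance (F p) k
    in
    ∀ n → 4 ≤ n →
    A n ≡
        2 * 2 ^ d n 1 * (d n 1) ! * (b n 1 ∸ d n 1) !
          * ∏[ 2 ⋯ n ∸ 1 ] (λ j → 2 ^ d n j * (b n j) !)
      + 2 * 2 ^ d (n ∸ 1) 1 * (d (n ∸ 1) 1 + 1) ! * (b (n ∸ 1) 1 ∸ d (n ∸ 1) 1) !
          * ∏[ 2 ⋯ n ∸ 1 ] (λ j → 2 ^ d (n ∸ 1) j * (b (n ∸ 1) j) !)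
      + ∑[ 3 ⋯ n ∸ 2 ] (λ i →
          2 ^ (d i 1 + d (n + 1 ∸ i) 1) * (d i 1 + d (n + 1 ∸ i) 1) !
            * (b i 1 + b (n + 1 ∸ i) 1 ∸ d i 1 ∸ d (n + 1 ∸ i) 1) !
            * ∏[ 2 ⋯ n ∸ 1 ] (λ j →
                2 ^ (d i j + d (n + 1 ∸ i) j) * (b i j + b (n + 1 ∸ i) j) !))
mainTheorem8 F (suc (suc (suc (suc N)))) (s≤s (s≤s (s≤s (s≤s z≤n)))) = trans (A-weight (3 + N))
  (trans (sum-symmetric-ends w N outer inner)
    (cong₂ _+_ (cong₂ _+_ first second) (sum-cong-< N third)))
  where
  b d : ℕ → ℕ → ℕ
  b p k = personsAtDistance (F p) k
  d p k = pairsAtDistance (F p) k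
  b-end : ∀ q k → b (suc q) k ≡ endPersons k q
  b-end q = personsAtDistance-end (F (suc q))
  d-end : ∀ q k → d (suc q) k ≡ endPairs k q
  d-end q = pairsAtDistance-end (F (suc q))
  w : ℕ → ℕ
  w i = weight (4 + N) (ends i (3 + N ∸ i))
  outer : w 0 ≡ w (3 + N)
  outer = trans (weight-swap (4 + N) 0 (3 + N)) (cong (λ j → weight (4 + N) (ends (3 + N) j)) (sym (n∸n≡0 N)))
  inner : w 1 ≡ w (2 + N)
  inner = trans (weight-swap (4 + N) 1 (2 + N)) (cong (λ j → weight (4 + N) (ends (2 + N) j)) (sym (m+n∸n≡m 1 N)))
  first = trans (cong (2 *_) (weight-first {b} {d} b-end d-end (2 + N) (1 + N)))
    (double-summand (d (4 + N) 1) (d (4 + N) 1) (b (4 + N) 1 ∸ d (4 + N) 1) _)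
  second = trans (cong (2 *_) (weight-second {b} {d} b-end d-end (2 + N) N))
    (double-summand (d (3 + N) 1) (d (3 + N) 1 + 1) (b (3 + N) 1 ∸ d (3 + N) 1) _)
  product-of : ℕ → ℕ → ℕ
  product-of i j = 2 ^ (d i 1 + d j 1) * (d i 1 + d j 1) ! * (b i 1 + b j 1 ∸ d i 1 ∸ d j 1) !
                     * ∏[ 2 ⋯ 3 + N ] (λ l → 2 ^ (d i l + d j l) * (b i l + b j l) !)
  third : ∀ {i} → i < N → w (2 + i) ≡ product-of (3 + i) (4 + N + 1 ∸ (3 + i))
  third {i} i<N = trans (cong (λ j → weight (4 + N) (ends (2 + i) j)) left)
    (trans (weight-inner {b} {d} b-end d-end (2 + N) i r) (cong (product-of (3 + i)) (sym right)))
    where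
    -- The first person at `2 + i`, counted from 0, leaves end gaps of `2 + i` and `2 + r` places,
    -- which belong to the indices `3 + i` and `3 + r` of b and d.
    r : ℕ
    r = N ∸ suc i
    N≡ : i + suc r ≡ N
    N≡ = trans (+-suc i r) (m+[n∸m]≡n i<N)
    left : 1 + N ∸ i ≡ 2 + r
    left = trans (cong (λ n → 1 + n ∸ i) (sym N≡)) (trans (cong (_∸ i) (sym (+-suc i (suc r)))) (m+n∸m≡n i (2 + r)))
    right : 1 + (N + 1) ∸ i ≡ 3 + r
    right = trans (cong (λ n → 1 + n ∸ i) (+-comm N 1)) (trans (+-∸-assoc 1 (m≤n⇒m≤1+n (<⇒≤ i<N))) (cong suc left))
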